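{- For every sentence $\phi$ of the language of Level Theory: (1) if $\mathsf{LT}\vdash\phi$ then $\mathsf{BLT}\vdash\phi^{h}$; (2) if $\mathsf{LT}^+\vdash\phi$ then $\mathsf{BLT}^+\vdash\phi^{h}$; (3) if $\mathsf{ZF}\vdash\phi$ then $\mathsf{BLT}_{\mathrm{ZF}}\vdash\phi^{h}$, where $\phi^h$ is obtained from $\phi$ by restricting all its quantifiers to helow sets.
   Context: All theories are classical second-order with Comprehension and sole primitive $\in$. Level Theory $\mathsf{LT}$: Extensionality, Separation $\forall F\forall a\exists b\forall x(x\in b\leftrightarrow(F(x)\land x\in a))$, Stratification (every set is a subset of a level), where $\mathrm{pot}(a)=\{x:\exists c(x\subseteq c\in a)\}$, a history is an $h$ with $x=\mathrm{pot}(x\cap h)$ for $x\in h$, and a level is $\mathrm{pot}(h)$ for a history $h$. $\mathsf{LT}^+=\mathsf{LT}+$Endless (every level is a member of some level). $\mathsf{ZF}$ is Zermelo–Fraenkel set theory. Boolean Level Theory $\mathsf{BLT}$: with $\overline a=\{x:x\notin a\}$, $\mathrm{bpot}(a)=\{x:\exists c(c\in a\land c\notin c\land(x\subseteq c\lor\overline x\subseteq c))\}$, boolean-history: $h\notin h$ and $x=\mathrm{bpot}(x\cap h)$ for $x\in h$, boolean-level: $\mathrm{bpot}(h)$ for a boolean-history $h$; axioms Extensionality, Complements $\forall a\exists c(c=\overline a\land(a\notin a\leftrightarrow c\in c))$, Separation$_\notin$ $\forall F\forall a(a\notin a\to\exists b(b\notin b\land\forall x(x\in b\leftrightarrow(F(x)\land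 x\in a))))$, Stratification$_\notin$ (every non-self-membered set is a subset of some boolean-level). $\mathsf{BLT}^+=\mathsf{BLT}+$Endless$_\notin$ (every boolean-level is a member of some boolean-level). $\mathsf{BLT}_{\mathrm{ZF}}=\mathsf{BLT}+$Infinity$_\notin$ (some boolean-level has a boolean-level member and, for each boolean-level $q$ in it, a boolean-level $r$ with $q\in r$ in it) $+$Unbounded$_\notin$ (for every second-order function $P$ and every $a\notin a$ there is a boolean-level $s$ with $P(x)\in s$ for all $x\in a$). A set $a$ is helow iff there is a transitive set $c\supseteq a$ such that $x\notin x$ for every $x\in c$. -}

module Defs where

open import Data.Nat using (ℕ; zero; suc; _∸_; _<_; _≟_)
open import Data.Bool using (if_then_else_)
open import Data.Vec using (Vec; []; _∷_; tabulate; map)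
open import Data.Vec.Relation.Unary.All using (All)
open import Data.Fin using (toℕ)
open import Data.List using (List; []; _∷_)
open import Data.List.Membership.Propositional using (_∈_)
open import Data.Product using (_×_)
open import Data.Unit using (⊤)
open import Relation.Nullary using (does)

-- Formulas (de Bruijn indices).  First-order variables form one index
-- space; relation variables of arity k form a separate index space for
-- each k.  Equality is a logical symbol.

infixr 5 _⇒_

data Fm : Set where
  mem  : ℕ → ℕ → Fm
  eql  : ℕ → ℕ → Fm
  rel  : (k i : ℕ) → Vec ℕ k → Fm
  ⊥'   : Fm
  _⇒_  : Fm → Fm → Fm
  ∀₁   : Fm → Fm                    -- binds first-order index 0
  ∀₂   : ℕ → Fm → Fm                -- ∀₂ k : binds arity-k relation index 0

¬' : Fm → Fm
¬' φ = φ ⇒ ⊥'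

_∧'_ : Fm → Fm → Fm
φ ∧' ψ = ¬' (φ ⇒ ¬' ψ)

_∨'_ : Fm → Fm → Fm
φ ∨' ψ = ¬' φ ⇒ ψ

_⇔'_ : Fm → Fm → Fm
φ ⇔' ψ = (φ ⇒ ψ) ∧' (ψ ⇒ φ)

∃₁ : Fm → Fm
∃₁ φ = ¬' (∀₁ (¬' φ))

∃₂ : ℕ → Fm → Fm
∃₂ k φ = ¬' (∀₂ k (¬' φ))

ext : (ℕ → ℕ) → ℕ → ℕ
ext ρ zero    = zero
ext ρ (suc n) = suc (ρ n)

inst : ℕ → ℕ → ℕ
inst y zero    = y
inst y (suc n) = n

ren1 : (ℕ → ℕ) → Fm → Fm
ren1 ρ (mem x y)    = mem (ρ x) (ρ y)
ren1 ρ (eql x y)    = eql (ρ x) (ρ y)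
ren1 ρ (rel k i xs) = rel k i (map ρ xs)
ren1 ρ ⊥'           = ⊥'
ren1 ρ (φ ⇒ ψ)      = ren1 ρ φ ⇒ ren1 ρ ψ
ren1 ρ (∀₁ φ)       = ∀₁ (ren1 (ext ρ) φ)
ren1 ρ (∀₂ j φ)     = ∀₂ j (ren1 ρ φ)

ren2 : (k : ℕ) → (ℕ → ℕ) → Fm → Fm
ren2 k ρ (mem x y)    = mem x y
ren2 k ρ (eql x y)    = eql x y
ren2 k ρ (rel j i xs) = if does (j ≟ k) then rel j (ρ i) xs else rel j i xs
ren2 k ρ ⊥'           = ⊥'
ren2 k ρ (φ ⇒ ψ)      = ren2 k ρ φ ⇒ ren2 k ρ ψ
ren2 k ρ (∀₁ φ)       = ∀₁ (ren2 k ρ φ)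
ren2 k ρ (∀₂ j φ)     = ∀₂ j (ren2 k (if does (j ≟ k) then ext ρ else ρ) φ)

Bnd : ℕ → (ℕ → ℕ) → Fm → Set
Bnd n r (mem x y)    = x < n × y < n
Bnd n r (eql x y)    = x < n × y < n
Bnd n r (rel k i xs) = i < r k × All (_< n) xs
Bnd n r ⊥'           = ⊤
Bnd n r (φ ⇒ ψ)      = Bnd n r φ × Bnd n r ψ
Bnd n r (∀₁ φ)       = Bnd (suc n) r φ
Bnd n r (∀₂ k φ)     = Bnd n (λ j → if does (j ≟ k) then suc (r j) else r j) φ

Sentence : Fm → Set
Sentence = Bnd 0 (λ _ → 0)

∀₁ⁿ : ℕ → Fm → Fm
∀₁ⁿ zero    φ = φ
∀₁ⁿ (suc n) φ = ∀₁ (∀₁ⁿ n φ)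

-- Comprehension instance for arity k and a formula ψ whose indices
-- 0 … k-1 are the arguments (all other free variables are parameters):
--   ∃R ∀x₁…x_k (R(x⃗) ↔ ψ)
comprehension : (k : ℕ) → Fm → Fm
comprehension k ψ =
  ∃₂ k (∀₁ⁿ k (rel k 0 (tabulate toℕ) ⇔' ren2 k suc ψ))

data LogAx : Fm → Set where
  ax-K    : ∀ φ ψ → LogAx (φ ⇒ ψ ⇒ φ)
  ax-S    : ∀ φ ψ χ → LogAx ((φ ⇒ ψ ⇒ χ) ⇒ (φ ⇒ ψ) ⇒ φ ⇒ χ)
  ax-DN   : ∀ φ → LogAx (¬' (¬' φ) ⇒ φ)
  ax-∀₁e  : ∀ φ y → LogAx (∀₁ φ ⇒ ren1 (inst y) φ)
  ax-∀₁d  : ∀ φ ψ → LogAx (∀₁ (ren1 suc φ ⇒ ψ) ⇒ φ ⇒ ∀₁ ψ)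
  ax-∀₂e  : ∀ k φ i → LogAx (∀₂ k φ ⇒ ren2 k (inst i) φ)
  ax-∀₂d  : ∀ k φ ψ → LogAx (∀₂ k (ren2 k suc φ ⇒ ψ) ⇒ φ ⇒ ∀₂ k ψ)
  ax-refl : ∀ x → LogAx (eql x x)
  ax-leib : ∀ x y φ → LogAx (eql x y ⇒ ren1 (inst x) φ ⇒ ren1 (inst y) φ)
  ax-comp : ∀ k ψ → LogAx (comprehension k ψ)

Theory : Set₁
Theory = Fm → Set

infix 3 _⊢_

data _⊢_ (T : Theory) : Fm → Set where
  logax : ∀ {φ} → LogAx φ → T ⊢ φ
  hyp   : ∀ {φ} → T φ → T ⊢ φ
  mp    : ∀ {φ ψ} → T ⊢ φ ⇒ ψ → T ⊢ φ → T ⊢ ψ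
  gen₁  : ∀ {φ} → T ⊢ φ → T ⊢ ∀₁ φ
  gen₂  : ∀ {k φ} → T ⊢ φ → T ⊢ ∀₂ k φ

-- Builders: write formulas with variables referred to by de Bruijn
-- LEVELS; a builder receives the current binder depths.

record Depth : Set where
  constructor dp
  field d0 d1 d2 : ℕ
open Depth

B : Set
B = Depth → Fm

ix : ℕ → ℕ → ℕ
ix d l = d ∸ suc l

infix 7 _∈ᵇ_ _≐ᵇ_ _∉ᵇ_
infixr 6 _∧ᵇ_
infixr 5 _∨ᵇ_
infixr 4 _⇒ᵇ_ _⇔ᵇ_

_∈ᵇ_ : ℕ → ℕ → B
(x ∈ᵇ y) c = mem (ix (d0 c) x) (ix (d0 c) y)

_≐ᵇ_ : ℕ → ℕ → B
(x ≐ᵇ y) c = eql (ix (d0 c) x) (ix (d0 c) y)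

F1 : ℕ → ℕ → B
F1 p x c = rel 1 (ix (d1 c) p) (ix (d0 c) x ∷ [])

F2 : ℕ → ℕ → ℕ → B
F2 p x y c = rel 2 (ix (d2 c) p) (ix (d0 c) x ∷ ix (d0 c) y ∷ [])

¬ᵇ : B → B
¬ᵇ φ c = ¬' (φ c)

_⇒ᵇ_ _∧ᵇ_ _∨ᵇ_ _⇔ᵇ_ : B → B → B
(φ ⇒ᵇ ψ) c = φ c ⇒ ψ c
(φ ∧ᵇ ψ) c = φ c ∧' ψ c
(φ ∨ᵇ ψ) c = φ c ∨' ψ c
(φ ⇔ᵇ ψ) c = φ c ⇔' ψ c

_∉ᵇ_ : ℕ → ℕ → B
x ∉ᵇ y = ¬ᵇ (x ∈ᵇ y)

∀ᵇ : (ℕ → B) → B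
∀ᵇ f (dp a b e) = ∀₁ (f a (dp (suc a) b e))

∃ᵇ : (ℕ → B) → B
∃ᵇ f = ¬ᵇ (∀ᵇ (λ x → ¬ᵇ (f x)))

∀F1 : (ℕ → B) → B
∀F1 f (dp a b e) = ∀₂ 1 (f b (dp a (suc b) e))

∀F2 : (ℕ → B) → B
∀F2 f (dp a b e) = ∀₂ 2 (f e (dp a b (suc e)))

∀∈ : ℕ → (ℕ → B) → B
∀∈ a f = ∀ᵇ (λ x → x ∈ᵇ a ⇒ᵇ f x)

∃∈ : ℕ → (ℕ → B) → B
∃∈ a f = ∃ᵇ (λ x → x ∈ᵇ a ∧ᵇ f x)

run : B → Fm
run φ = φ (dp 0 0 0)

_⊆ᵇ_ : ℕ → ℕ → B
x ⊆ᵇ y = ∀ᵇ (λ z → z ∈ᵇ x ⇒ᵇ z ∈ᵇ y)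

compl⊆ᵇ : ℕ → ℕ → B
compl⊆ᵇ x c = ∀ᵇ (λ z → z ∉ᵇ x ⇒ᵇ z ∈ᵇ c)

-- z ∈ pot(a ∩ h)   (a ∩ h given by the two sets; pot(h) when a = h)
inPot∩ : ℕ → ℕ → ℕ → B
inPot∩ z a h = ∃ᵇ (λ c → z ⊆ᵇ c ∧ᵇ c ∈ᵇ a ∧ᵇ c ∈ᵇ h)

inPot : ℕ → ℕ → B
inPot z h = ∃ᵇ (λ c → z ⊆ᵇ c ∧ᵇ c ∈ᵇ h)

History : ℕ → B
History h = ∀∈ h (λ x → ∀ᵇ (λ z → z ∈ᵇ x ⇔ᵇ inPot∩ z x h))

Level : ℕ → B
Level l = ∃ᵇ (λ h → History h ∧ᵇ ∀ᵇ (λ z → z ∈ᵇ l ⇔ᵇ inPot z h))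

inBpot∩ : ℕ → ℕ → ℕ → B
inBpot∩ z a h = ∃ᵇ (λ c → c ∈ᵇ a ∧ᵇ c ∈ᵇ h ∧ᵇ c ∉ᵇ c ∧ᵇ (z ⊆ᵇ c ∨ᵇ compl⊆ᵇ z c))

inBpot : ℕ → ℕ → B
inBpot z h = ∃ᵇ (λ c → c ∈ᵇ h ∧ᵇ c ∉ᵇ c ∧ᵇ (z ⊆ᵇ c ∨ᵇ compl⊆ᵇ z c))

BHistory : ℕ → B
BHistory h = h ∉ᵇ h ∧ᵇ ∀∈ h (λ x → ∀ᵇ (λ z → z ∈ᵇ x ⇔ᵇ inBpot∩ z x h))

BLevel : ℕ → B
BLevel l = ∃ᵇ (λ h → BHistory h ∧ᵇ ∀ᵇ (λ z → z ∈ᵇ l ⇔ᵇ inBpot z h))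

Func : ℕ → B
Func P = ∀ᵇ (λ x → ∃ᵇ (λ y → F2 P x y ∧ᵇ ∀ᵇ (λ y' → F2 P x y' ⇒ᵇ y' ≐ᵇ y)))

Transitive : ℕ → B
Transitive c = ∀∈ c (λ y → ∀∈ y (λ z → z ∈ᵇ c))

Helow : ℕ → B
Helow a = ∃ᵇ (λ c → Transitive c ∧ᵇ a ⊆ᵇ c ∧ᵇ ∀∈ c (λ x → x ∉ᵇ x))

Extensionality : Fm
Extensionality = run (∀ᵇ λ a → ∀ᵇ λ b →
  ∀ᵇ (λ x → x ∈ᵇ a ⇔ᵇ x ∈ᵇ b) ⇒ᵇ a ≐ᵇ b)

Separation : Fm
Separation = run (∀F1 λ F → ∀ᵇ λ a → ∃ᵇ λ b →
  ∀ᵇ (λ x → x ∈ᵇ b ⇔ᵇ (F1 F x ∧ᵇ x ∈ᵇ a)))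

Stratification : Fm
Stratification = run (∀ᵇ λ a → ∃ᵇ λ l → Level l ∧ᵇ a ⊆ᵇ l)

Endless : Fm
Endless = run (∀ᵇ λ l → Level l ⇒ᵇ ∃ᵇ (λ m → Level m ∧ᵇ l ∈ᵇ m))

Complements : Fm
Complements = run (∀ᵇ λ a → ∃ᵇ λ c →
  ∀ᵇ (λ x → x ∈ᵇ c ⇔ᵇ x ∉ᵇ a) ∧ᵇ (a ∉ᵇ a ⇔ᵇ c ∈ᵇ c))

Separation∉ : Fm
Separation∉ = run (∀F1 λ F → ∀ᵇ λ a → a ∉ᵇ a ⇒ᵇ ∃ᵇ λ b →
  b ∉ᵇ b ∧ᵇ ∀ᵇ (λ x → x ∈ᵇ b ⇔ᵇ (F1 F x ∧ᵇ x ∈ᵇ a)))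

Stratification∉ : Fm
Stratification∉ = run (∀ᵇ λ a → a ∉ᵇ a ⇒ᵇ ∃ᵇ λ l → BLevel l ∧ᵇ a ⊆ᵇ l)

Endless∉ : Fm
Endless∉ = run (∀ᵇ λ l → BLevel l ⇒ᵇ ∃ᵇ (λ m → BLevel m ∧ᵇ l ∈ᵇ m))

Infinity∉ : Fm
Infinity∉ = run (∃ᵇ λ l → BLevel l ∧ᵇ ∃∈ l (λ q → BLevel q)
  ∧ᵇ ∀∈ l (λ q → BLevel q ⇒ᵇ ∃∈ l (λ r → BLevel r ∧ᵇ q ∈ᵇ r)))

Unbounded∉ : Fm
Unbounded∉ = run (∀F2 λ P → Func P ⇒ᵇ ∀ᵇ λ a → a ∉ᵇ a ⇒ᵇ
  ∃ᵇ λ s → BLevel s ∧ᵇ ∀∈ a (λ x → ∃ᵇ (λ y → F2 P x y ∧ᵇ y ∈ᵇ s)))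

-- ZF (second-order: Separation and Replacement quantify over relations)
Pairing : Fm
Pairing = run (∀ᵇ λ a → ∀ᵇ λ b → ∃ᵇ λ c →
  ∀ᵇ (λ x → x ∈ᵇ c ⇔ᵇ (x ≐ᵇ a ∨ᵇ x ≐ᵇ b)))

Union : Fm
Union = run (∀ᵇ λ a → ∃ᵇ λ u →
  ∀ᵇ (λ y → y ∈ᵇ u ⇔ᵇ ∃∈ a (λ x → y ∈ᵇ x)))

Powerset : Fm
Powerset = run (∀ᵇ λ a → ∃ᵇ λ p → ∀ᵇ (λ x → x ∈ᵇ p ⇔ᵇ x ⊆ᵇ a))

Infinity : Fm
Infinity = run (∃ᵇ λ w → ∃∈ w (λ e → ∀ᵇ (λ z → z ∉ᵇ e))
  ∧ᵇ ∀∈ w (λ x → ∃∈ w (λ s → ∀ᵇ (λ z → z ∈ᵇ s ⇔ᵇ (z ∈ᵇ x ∨ᵇ z ≐ᵇ x)))))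

Replacement : Fm
Replacement = run (∀F2 λ P → Func P ⇒ᵇ ∀ᵇ λ a → ∃ᵇ λ b →
  ∀ᵇ (λ y → y ∈ᵇ b ⇔ᵇ ∃∈ a (λ x → F2 P x y)))

Foundation : Fm
Foundation = run (∀ᵇ λ a → ∃ᵇ (λ x → x ∈ᵇ a) ⇒ᵇ
  ∃∈ a (λ x → ∀ᵇ (λ z → z ∈ᵇ x ⇒ᵇ z ∉ᵇ a)))

LT-axioms : List Fm
LT-axioms = Extensionality ∷ Separation ∷ Stratification ∷ []

LT : Theory
LT φ = φ ∈ LT-axioms

LT⁺ : Theory
LT⁺ φ = φ ∈ (Endless ∷ LT-axioms)

ZF : Theory
ZF φ = φ ∈ (Extensionality ∷ Separation ∷ Pairing ∷ Union ∷ Powerset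
            ∷ Infinity ∷ Replacement ∷ Foundation ∷ [])

BLT-axioms : List Fm
BLT-axioms = Extensionality ∷ Complements ∷ Separation∉ ∷ Stratification∉ ∷ []

BLT : Theory
BLT φ = φ ∈ BLT-axioms

BLT⁺ : Theory
BLT⁺ φ = φ ∈ (Endless∉ ∷ BLT-axioms)

BLT-ZF : Theory
BLT-ZF φ = φ ∈ (Infinity∉ ∷ Unbounded∉ ∷ BLT-axioms)

Helow₀ : Fm
Helow₀ = Helow 0 (dp 1 0 0)

_ʰ : Fm → Fm
mem x y ʰ    = mem x y
eql x y ʰ    = eql x y
rel k i xs ʰ = rel k i xs
⊥' ʰ         = ⊥'
(φ ⇒ ψ) ʰ    = φ ʰ ⇒ ψ ʰ
∀₁ φ ʰ       = ∀₁ (Helow₀ ⇒ φ ʰ)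
∀₂ k φ ʰ     = ∀₂ k (φ ʰ)

{-# OPTIONS --safe #-}
module Submission where

-- It suffices to prove φ ʰ in all models of the target theory: the calculus is
-- complete for models in which ⊥' may be any proposition for which the atoms
-- are stable, and this completeness theorem (Krivine) is constructive.
--
-- In a model of BLT call a set low if it is not a member of itself.  Let s be
-- the boolean-level bpot(h), and let H consist of the low members of h.
-- Membership is well-founded on H, which implies that a low set cannot have its
-- complement included in a member of H.  Hence the low members of s are exactly
-- the low subsets of members of H, and the members of H are transitive as far
-- as low sets are concerned.  So for d in H ∪ {s} the helow members of d form
-- a helow set d°, and {d° : d ∈ H} is, among the helow sets, a history in
-- the sense of LT whose level is s°.  Stratification, and with it LT, follows;
-- the other axioms are obtained by separating from such sets s°.

open import Defs
open import Data.Bool using (true; false; if_then_else_)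
import Data.Empty as Empty
open import Data.List as List using (List; []; _∷_; _++_)
open import Data.List.Membership.Propositional using (_∈_)
open import Data.List.Relation.Binary.Subset.Propositional using (_⊆_)
open import Data.List.Relation.Binary.Subset.Propositional.Properties using (xs⊆xs++ys; xs⊆ys++xs)
open import Data.List.Relation.Unary.All as All using (All; []; _∷_)
open import Data.List.Relation.Unary.All.Properties using (++⁺)
open import Data.List.Relation.Unary.Any using (here; there)
open import Data.Nat using (ℕ; zero; suc; _+_; _∸_; _⊔_; _≤_; _<_; _≟_; _<?_; s≤s; s≤s⁻¹; _≤′_; ≤′-refl; ≤′-step)
open import Data.Nat.Properties using (m+n∸m≡n; m+n≮m; m≤m⊔n; m≤n⊔m; ≤-trans; <-≤-trans; ≤-refl; n≤1+n; <-irrefl; ≤⇒≤′; +-identityʳ; +-suc; suc-injective; ≤∧≢⇒<)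
open import Data.Product using (Σ; _×_; _,_; proj₁; proj₂)
open import Data.Sum using (_⊎_; inj₁; inj₂)
open import Data.Vec using (Vec; []; _∷_; map)
open import Data.Vec.Properties using (map-∘; map-id; map-cong)
open import Data.Vec.Relation.Unary.All using ([]; _∷_) renaming (All to VecAll)
open import Function using (id; _∘_; case_of_)
open import Relation.Nullary using (does; proof; ofʸ; ofⁿ; yes; no)
open import Relation.Binary.PropositionalEquality using (_≡_; refl; sym; trans; cong; cong₂; subst; subst₂)

-- Simultaneous renaming

extAt : ℕ → (ℕ → ℕ → ℕ) → ℕ → ℕ → ℕ
extAt k σ j = if does (j ≟ k) then ext (σ j) else σ j

-- Acting on both sorts of variable at once makes `ren1` and `ren2` special cases, so the laws of
-- identity, composition and congruence are proved only once.
ren : (ℕ → ℕ) → (ℕ → ℕ → ℕ) → Fm → Fm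
ren ρ σ (mem x y)    = mem (ρ x) (ρ y)
ren ρ σ (eql x y)    = eql (ρ x) (ρ y)
ren ρ σ (rel k i xs) = rel k (σ k i) (map ρ xs)
ren ρ σ ⊥'           = ⊥'
ren ρ σ (φ ⇒ ψ)      = ren ρ σ φ ⇒ ren ρ σ ψ
ren ρ σ (∀₁ φ)       = ∀₁ (ren (ext ρ) σ φ)
ren ρ σ (∀₂ k φ)     = ∀₂ k (ren ρ (extAt k σ) φ)

maxVec : ∀ {k} → Vec ℕ k → ℕ
maxVec []       = 0
maxVec (x ∷ xs) = suc x ⊔ maxVec xs

-- A crude strict upper bound on indices and arities: binders are not
-- subtracted, so it bounds subformulas as well.
bound : Fm → ℕ
bound (mem x y)    = suc x ⊔ suc y
bound (eql x y)    = suc x ⊔ suc y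
bound (rel k i xs) = suc k ⊔ (suc i ⊔ maxVec xs)
bound ⊥'           = 0
bound (φ ⇒ ψ)      = bound φ ⊔ bound ψ
bound (∀₁ φ)       = bound φ
bound (∀₂ k φ)     = bound φ

_≗[_]_ : (ℕ → ℕ) → ℕ → (ℕ → ℕ) → Set
ρ ≗[ n ] ρ' = ∀ x → x < n → ρ x ≡ ρ' x

_≗₂[_]_ : (ℕ → ℕ → ℕ) → ℕ → (ℕ → ℕ → ℕ) → Set
σ ≗₂[ n ] σ' = ∀ k i → k < n → i < n → σ k i ≡ σ' k i

id₂ : ℕ → ℕ → ℕ
id₂ _ i = i

_∘₂_ : (ℕ → ℕ → ℕ) → (ℕ → ℕ → ℕ) → ℕ → ℕ → ℕ
(σ' ∘₂ σ) k i = σ' k (σ k i)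

ext-≗ : ∀ {n ρ ρ'} → ρ ≗[ n ] ρ' → ext ρ ≗[ n ] ext ρ'
ext-≗ e zero    _ = refl
ext-≗ e (suc x) p = cong suc (e x (≤-trans (n≤1+n _) p))

ext-id : ∀ x → ext id x ≡ x
ext-id zero    = refl
ext-id (suc x) = refl

ext-∘ : ∀ ρ' ρ x → ext ρ' (ext ρ x) ≡ ext (ρ' ∘ ρ) x
ext-∘ ρ' ρ zero    = refl
ext-∘ ρ' ρ (suc x) = refl

extAt-≗ : ∀ {n σ σ'} k → σ ≗₂[ n ] σ' → extAt k σ ≗₂[ n ] extAt k σ'
extAt-≗ k e j i p q with does (j ≟ k)
... | true  = ext-≗ (λ x r → e j x p r) i q
... | false = e j i p q

extAt-id : ∀ k j i → extAt k id₂ j i ≡ i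
extAt-id k j i with does (j ≟ k)
... | true  = ext-id i
... | false = refl

extAt-∘ : ∀ k σ' σ j i → extAt k σ' j (extAt k σ j i) ≡ extAt k (σ' ∘₂ σ) j i
extAt-∘ k σ' σ j i with does (j ≟ k)
... | true  = ext-∘ (σ' j) (σ j) i
... | false = refl

≗-⊔ˡ : ∀ m n {ρ ρ' : ℕ → ℕ} → ρ ≗[ m ⊔ n ] ρ' → ρ ≗[ m ] ρ'
≗-⊔ˡ m n e x p = e x (<-≤-trans p (m≤m⊔n m n))

≗-⊔ʳ : ∀ m n {ρ ρ' : ℕ → ℕ} → ρ ≗[ m ⊔ n ] ρ' → ρ ≗[ n ] ρ'
≗-⊔ʳ m n e x p = e x (<-≤-trans p (m≤n⊔m m n))

≗₂-⊔ˡ : ∀ m n {σ σ'} → σ ≗₂[ m ⊔ n ] σ' → σ ≗₂[ m ] σ'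
≗₂-⊔ˡ m n e k i p q = e k i (<-≤-trans p (m≤m⊔n m n)) (<-≤-trans q (m≤m⊔n m n))

≗₂-⊔ʳ : ∀ m n {σ σ'} → σ ≗₂[ m ⊔ n ] σ' → σ ≗₂[ n ] σ'
≗₂-⊔ʳ m n e k i p q = e k i (<-≤-trans p (m≤n⊔m m n)) (<-≤-trans q (m≤n⊔m m n))

map-≗ : ∀ {k ρ ρ'} (xs : Vec ℕ k) → ρ ≗[ maxVec xs ] ρ' → map ρ xs ≡ map ρ' xs
map-≗ []       e = refl
map-≗ (x ∷ xs) e = cong₂ _∷_ (≗-⊔ˡ (suc x) (maxVec xs) e x ≤-refl) (map-≗ xs (≗-⊔ʳ (suc x) _ e))

ren-cong : ∀ φ {ρ ρ' σ σ'} → ρ ≗[ bound φ ] ρ' → σ ≗₂[ bound φ ] σ' →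
           ren ρ σ φ ≡ ren ρ' σ' φ
ren-cong (mem x y) e f = cong₂ mem (≗-⊔ˡ (suc x) (suc y) e x ≤-refl) (≗-⊔ʳ (suc x) (suc y) e y ≤-refl)
ren-cong (eql x y) e f = cong₂ eql (≗-⊔ˡ (suc x) (suc y) e x ≤-refl) (≗-⊔ʳ (suc x) (suc y) e y ≤-refl)
ren-cong (rel k i xs) e f =
  cong₂ (rel k)
    (f k i (m≤m⊔n (suc k) n) (≤-trans (m≤m⊔n (suc i) (maxVec xs)) (m≤n⊔m (suc k) n)))
    (map-≗ xs (≗-⊔ʳ (suc i) _ (≗-⊔ʳ (suc k) n e)))
  where n = suc i ⊔ maxVec xs
ren-cong ⊥'       e f = refl
ren-cong (φ ⇒ ψ)  e f =
  cong₂ _⇒_ (ren-cong φ (≗-⊔ˡ (bound φ) _ e) (≗₂-⊔ˡ (bound φ) _ f))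
            (ren-cong ψ (≗-⊔ʳ (bound φ) _ e) (≗₂-⊔ʳ (bound φ) _ f))
ren-cong (∀₁ φ)   e f = cong ∀₁ (ren-cong φ (ext-≗ e) f)
ren-cong (∀₂ k φ) e f = cong (∀₂ k) (ren-cong φ e (extAt-≗ k f))

ren-≗ : ∀ φ {ρ ρ' σ σ'} → (∀ x → ρ x ≡ ρ' x) → (∀ k i → σ k i ≡ σ' k i) →
        ren ρ σ φ ≡ ren ρ' σ' φ
ren-≗ φ e f = ren-cong φ (λ x _ → e x) (λ k i _ _ → f k i)

ren-id : ∀ φ → ren id id₂ φ ≡ φ
ren-id (mem x y)    = refl
ren-id (eql x y)    = refl
ren-id (rel k i xs) = cong (rel k i) (map-id xs)
ren-id ⊥'           = refl
ren-id (φ ⇒ ψ)      = cong₂ _⇒_ (ren-id φ) (ren-id ψ)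
ren-id (∀₁ φ)       = cong ∀₁ (trans (ren-≗ φ ext-id (λ _ _ → refl)) (ren-id φ))
ren-id (∀₂ k φ)     = cong (∀₂ k) (trans (ren-≗ φ (λ _ → refl) (extAt-id k)) (ren-id φ))

ren-∘ : ∀ φ {ρ' ρ σ' σ} → ren ρ' σ' (ren ρ σ φ) ≡ ren (ρ' ∘ ρ) (σ' ∘₂ σ) φ
ren-∘ (mem x y)    = refl
ren-∘ (eql x y)    = refl
ren-∘ (rel k i xs) = cong (rel k _) (sym (map-∘ _ _ xs))
ren-∘ ⊥'           = refl
ren-∘ (φ ⇒ ψ)      = cong₂ _⇒_ (ren-∘ φ) (ren-∘ ψ)
ren-∘ (∀₁ φ) {ρ'} {ρ} =
  cong ∀₁ (trans (ren-∘ φ) (ren-≗ φ (ext-∘ ρ' ρ) (λ _ _ → refl)))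
ren-∘ (∀₂ k φ) {σ' = σ'} {σ} =
  cong (∀₂ k) (trans (ren-∘ φ) (ren-≗ φ (λ _ → refl) (extAt-∘ k σ' σ)))

at : ℕ → (ℕ → ℕ) → ℕ → ℕ → ℕ
at k τ j = if does (j ≟ k) then τ else id

ren1-ren : ∀ ρ φ → ren1 ρ φ ≡ ren ρ id₂ φ
ren1-ren ρ (mem x y)    = refl
ren1-ren ρ (eql x y)    = refl
ren1-ren ρ (rel k i xs) = refl
ren1-ren ρ ⊥'           = refl
ren1-ren ρ (φ ⇒ ψ)      = cong₂ _⇒_ (ren1-ren ρ φ) (ren1-ren ρ ψ)
ren1-ren ρ (∀₁ φ)       = cong ∀₁ (ren1-ren (ext ρ) φ)
ren1-ren ρ (∀₂ k φ)     =
  cong (∀₂ k) (trans (ren1-ren ρ φ) (ren-≗ φ (λ _ → refl) (λ j i → sym (extAt-id k j i))))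

extAt-at : ∀ k j τ l i → at k (if does (j ≟ k) then ext τ else τ) l i ≡ extAt j (at k τ) l i
extAt-at k j τ l i with does (l ≟ k) in l≟k | does (l ≟ j) in l≟j | proof (l ≟ k) | proof (l ≟ j)
... | true  | true  | ofʸ refl | ofʸ refl rewrite l≟k = refl
... | true  | false | ofʸ refl | ofⁿ l≢j  with does (j ≟ l) | proof (j ≟ l)
...   | true  | ofʸ refl = Empty.⊥-elim (l≢j refl)
...   | false | _        = refl
extAt-at k j τ l i | false | true  | _ | _ = sym (ext-id i)
extAt-at k j τ l i | false | false | _ | _ = refl

ren2-ren : ∀ k τ φ → ren2 k τ φ ≡ ren id (at k τ) φ
ren2-ren k τ (mem x y)    = refl
ren2-ren k τ (eql x y)    = refl
ren2-ren k τ (rel j i xs) with does (j ≟ k)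
... | true  = cong (rel j _) (sym (map-id xs))
... | false = cong (rel j _) (sym (map-id xs))
ren2-ren k τ ⊥'           = refl
ren2-ren k τ (φ ⇒ ψ)      = cong₂ _⇒_ (ren2-ren k τ φ) (ren2-ren k τ ψ)
ren2-ren k τ (∀₁ φ)       =
  cong ∀₁ (trans (ren2-ren k τ φ) (ren-≗ φ (λ x → sym (ext-id x)) (λ _ _ → refl)))
ren2-ren k τ (∀₂ j φ)     =
  cong (∀₂ j) (trans (ren2-ren k _ φ) (ren-≗ φ (λ _ → refl) (extAt-at k j τ)))

-- Renaming derivations

-- Indices from n on are lowered by n to make this a composite of n instantiations.
cutoff : ℕ → (ℕ → ℕ) → ℕ → ℕ
cutoff n ρ x with x <? n
... | yes _ = ρ x
... | no  _ = x ∸ n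

cutoff-< : ∀ n ρ → cutoff n ρ ≗[ n ] ρ
cutoff-< n ρ x p with x <? n
... | yes _ = refl
... | no x≮n = Empty.⊥-elim (x≮n p)

cutoff-≥ : ∀ n ρ x → cutoff n ρ (n + x) ≡ x
cutoff-≥ n ρ x with n + x <? n
... | yes p = Empty.⊥-elim (m+n≮m n x p)
... | no  _ = m+n∸m≡n n x

module _ {T : Theory} where

  rename₁-cofinite : ∀ n χ ρ → (∀ x → ρ (n + x) ≡ x) → T ⊢ χ → T ⊢ ren ρ id₂ χ
  rename₁-cofinite zero χ ρ e d =
    subst (T ⊢_) (trans (sym (ren-id χ)) (ren-≗ χ (λ x → sym (e x)) (λ _ _ → refl))) d
  rename₁-cofinite (suc n) χ ρ e d =
    subst (T ⊢_) eq
      (rename₁-cofinite n _ (ρ ∘ suc) e (mp (logax (ax-∀₁e χ y)) (gen₁ d)))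
    where
    -- By `e`, the remaining renaming `ρ ∘ suc` takes this index to `ρ 0`, the value wanted for
    -- index 0.
    y = n + ρ 0
    step : ∀ x → ρ (suc (inst y x)) ≡ ρ x
    step zero    = e (ρ 0)
    step (suc x) = refl
    eq : ren (ρ ∘ suc) id₂ (ren1 (inst y) χ) ≡ ren ρ id₂ χ
    eq = trans (cong (ren _ _) (ren1-ren _ χ)) (trans (ren-∘ χ) (ren-≗ χ step (λ _ _ → refl)))

  rename₁ : ∀ χ ρ → T ⊢ χ → T ⊢ ren ρ id₂ χ
  rename₁ χ ρ d =
    subst (T ⊢_) (ren-cong χ (cutoff-< (bound χ) ρ) (λ _ _ _ _ → refl))
      (rename₁-cofinite (bound χ) χ _ (cutoff-≥ (bound χ) ρ) d)

  rename₂-cofinite : ∀ k n χ τ → (∀ x → τ (n + x) ≡ x) → T ⊢ χ → T ⊢ ren id (at k τ) χ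
  rename₂-cofinite k zero χ τ e d =
    subst (T ⊢_) (trans (sym (ren-id χ)) (ren-≗ χ (λ x → refl) f)) d
    where
    f : ∀ j i → i ≡ at k τ j i
    f j i with does (j ≟ k)
    ... | true  = sym (e i)
    ... | false = refl
  rename₂-cofinite k (suc n) χ τ e d =
    subst (T ⊢_) eq
      (rename₂-cofinite k n _ (τ ∘ suc) e (mp (logax (ax-∀₂e k χ y)) (gen₂ d)))
    where
    y = n + τ 0
    step : ∀ x → τ (suc (inst y x)) ≡ τ x
    step zero    = e (τ 0)
    step (suc x) = refl
    f : ∀ j i → at k (τ ∘ suc) j (at k (inst y) j i) ≡ at k τ j i
    f j i with does (j ≟ k)
    ... | true  = step i
    ... | false = refl
    eq : ren id (at k (τ ∘ suc)) (ren2 k (inst y) χ) ≡ ren id (at k τ) χ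
    eq = trans (cong (ren _ _) (ren2-ren k _ χ)) (trans (ren-∘ χ) (ren-≗ χ (λ _ → refl) f))

  rename₂ : ∀ k χ τ → T ⊢ χ → T ⊢ ren id (at k τ) χ
  rename₂ k χ τ d =
    subst (T ⊢_) (ren-cong χ (λ _ _ → refl) f)
      (rename₂-cofinite k (bound χ) χ _ (cutoff-≥ (bound χ) τ) d)
    where
    f : at k (cutoff (bound χ) τ) ≗₂[ bound χ ] at k τ
    f j i _ q with does (j ≟ k)
    ... | true  = cutoff-< (bound χ) τ i q
    ... | false = refl

  -- `ren2` acts on one arity at a time; this is the result of treating all arities less than `n` in
  -- turn.
  below : ℕ → (ℕ → ℕ → ℕ) → ℕ → ℕ → ℕ
  below zero    σ = id₂
  below (suc n) σ j = if does (j ≟ n) then σ n else below n σ j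

  below-< : ∀ n σ j i → j < n → below n σ j i ≡ σ j i
  below-< (suc n) σ j i p with does (j ≟ n) | proof (j ≟ n)
  ... | true  | ofʸ refl = refl
  ... | false | ofⁿ j≢n   = below-< n σ j i (≤∧≢⇒< (s≤s⁻¹ p) j≢n)

  below-≥ : ∀ n σ j i → n ≤ j → below n σ j i ≡ i
  below-≥ zero    σ j i p = refl
  below-≥ (suc n) σ j i p with does (j ≟ n) | proof (j ≟ n)
  ... | true  | ofʸ refl = Empty.⊥-elim (<-irrefl refl p)
  ... | false | ofⁿ j≢n   = below-≥ n σ j i (≤-trans (n≤1+n n) p)

  rename-below : ∀ n χ ρ σ → T ⊢ χ → T ⊢ ren ρ (below n σ) χ
  rename-below zero    χ ρ σ d = rename₁ χ ρ d
  rename-below (suc n) χ ρ σ d =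
    subst (T ⊢_) (trans (ren-∘ χ) (ren-≗ χ (λ _ → refl) f))
      (rename₂ n _ (σ n) (rename-below n χ ρ σ d))
    where
    f : ∀ j i → at n (σ n) j (below n σ j i) ≡ below (suc n) σ j i
    f j i with does (j ≟ n) | proof (j ≟ n)
    ... | true  | ofʸ refl = cong (σ n) (below-≥ n σ n i ≤-refl)
    ... | false | _        = refl

  rename : ∀ χ ρ σ → T ⊢ χ → T ⊢ ren ρ σ χ
  rename χ ρ σ d =
    subst (T ⊢_) (ren-cong χ (λ _ _ → refl) (λ j i p _ → below-< (bound χ) σ j i p))
      (rename-below (bound χ) χ ρ σ d)

-- Enumerating formulas

-- Cantor's walk along the antidiagonals a + b = s, each from (s , 0) to (0 , s).
next : ℕ × ℕ → ℕ × ℕ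
next (zero  , b) = suc b , zero
next (suc a , b) = a , suc b

unpair : ℕ → ℕ × ℕ
unpair zero    = 0 , 0
unpair (suc n) = next (unpair n)

pair-on-diagonal : ∀ s b a → a + b ≡ s → Σ ℕ λ n → unpair n ≡ (a , b)
pair-on-diagonal s (suc b) a e =
  let n , p = pair-on-diagonal s b (suc a) (trans (sym (+-suc a b)) e) in suc n , cong next p
pair-on-diagonal zero    zero zero    e = 0 , refl
pair-on-diagonal (suc s) zero (suc a) e =
  let n , p = pair-on-diagonal s a zero (trans (sym (+-identityʳ a)) (suc-injective e))
  in suc n , cong next p

pair : ∀ a b → Σ ℕ λ n → unpair n ≡ (a , b)
pair a b = pair-on-diagonal (a + b) b a refl

decodeVec : ∀ k → ℕ → Vec ℕ k
decodeVec zero    c = []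
decodeVec (suc k) c = let x , d = unpair c in x ∷ decodeVec k d

encodeVec : ∀ {k} (xs : Vec ℕ k) → Σ ℕ λ c → decodeVec k c ≡ xs
encodeVec [] = 0 , refl
encodeVec (x ∷ xs) with encodeVec xs
... | d , refl with pair x d
...   | c , p = c , cong (λ (y , e) → y ∷ decodeVec _ e) p

decode  : ℕ → ℕ → Fm
decode′ : ℕ → ℕ × ℕ → Fm
decode zero    c = ⊥'
decode (suc n) c = decode′ n (unpair c)
decode′ n (0 , c) = let x , y = unpair c in mem x y
decode′ n (1 , c) = let x , y = unpair c in eql x y
decode′ n (2 , c) = let k , d = unpair c ; i , e = unpair d in rel k i (decodeVec k e)
decode′ n (3 , c) = let a , b = unpair c in decode n a ⇒ decode n b
decode′ n (4 , c) = ∀₁ (decode n c)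
decode′ n (5 , c) = let k , d = unpair c in ∀₂ k (decode n d)
decode′ n (_ , c) = ⊥'

height : Fm → ℕ
height (φ ⇒ ψ)  = suc (height φ ⊔ height ψ)
height (∀₁ φ)   = suc (height φ)
height (∀₂ k φ) = suc (height φ)
height _        = 1

-- The two sides of an implication are decoded with equal fuel though their heights may differ, so a
-- code has to work for all sufficiently large fuel.
encode : ∀ φ → Σ ℕ λ c → ∀ n → height φ ≤ n → decode n c ≡ φ
encode (mem x y) with pair x y
... | d , q with pair 0 d
...   | c , p = c , λ { (suc n) _ → trans (cong (decode′ n) p) (cong (λ (a , b) → mem a b) q) }
encode (eql x y) with pair x y
... | d , q with pair 1 d
...   | c , p = c , λ { (suc n) _ → trans (cong (decode′ n) p) (cong (λ (a , b) → eql a b) q) }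
encode (rel k i xs) with encodeVec xs
... | f , refl with pair i f
...   | e , r with pair k e
...     | d , q with pair 2 d
...       | c , p = c , λ { (suc n) _ → trans (cong (decode′ n) p)
  (trans (cong (λ (k , d) → let i , e = unpair d in rel k i (decodeVec k e)) q)
         (cong (λ (i , e) → rel k i (decodeVec k e)) r)) }
encode ⊥' with pair 6 0
... | c , p = c , λ { (suc n) _ → cong (decode′ n) p }
encode (φ ⇒ ψ) with encode φ | encode ψ
... | a , α | b , β with pair a b
...   | d , q with pair 3 d
...     | c , p = c , λ { (suc n) (s≤s h) → trans (cong (decode′ n) p)
  (trans (cong (λ (a , b) → decode n a ⇒ decode n b) q)
         (cong₂ _⇒_ (α n (≤-trans (m≤m⊔n _ _) h)) (β n (≤-trans (m≤n⊔m (height φ) _) h)))) }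
encode (∀₁ φ) with encode φ
... | a , α with pair 4 a
...   | c , p = c , λ { (suc n) (s≤s h) → trans (cong (decode′ n) p) (cong ∀₁ (α n h)) }
encode (∀₂ k φ) with encode φ
... | a , α with pair k a
...   | d , q with pair 5 d
...     | c , p = c , λ { (suc n) (s≤s h) → trans (cong (decode′ n) p)
  (trans (cong (λ (k , d) → ∀₂ k (decode n d)) q) (cong (∀₂ k) (α n h))) }

formula : ℕ → Fm
formula n = let h , c = unpair n in decode h c

formula-surjective : ∀ φ → Σ ℕ λ n → formula n ≡ φ
formula-surjective φ with encode φ
... | c , α with pair (height φ) c
...   | n , p = n , trans (cong (λ (h , c) → decode h c) p) (α (height φ) ≤-refl)

-- Derivations from finitely many hypotheses

-- The hypotheses are accumulated so that the deduction theorem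
-- holds by definition: Prov T (γ ∷ Γ) φ is Prov T Γ (γ ⇒ φ).
_⇛_ : List Fm → Fm → Fm
[]      ⇛ φ = φ
(γ ∷ Γ) ⇛ φ = Γ ⇛ (γ ⇒ φ)

Prov : Theory → List Fm → Fm → Set
Prov T Γ φ = T ⊢ Γ ⇛ φ

module _ {T : Theory} where

  lift⊢ : ∀ Γ {φ} → T ⊢ φ → Prov T Γ φ
  lift⊢ []      d = d
  lift⊢ (γ ∷ Γ) d = lift⊢ Γ (mp (logax (ax-K _ _)) d)

  mpᴾ : ∀ Γ {φ ψ} → Prov T Γ (φ ⇒ ψ) → Prov T Γ φ → Prov T Γ ψ
  mpᴾ []      d e = mp d e
  mpᴾ (γ ∷ Γ) d e = mpᴾ Γ (mpᴾ Γ (lift⊢ Γ (logax (ax-S _ _ _))) d) e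

  weaken : ∀ γ Γ {φ} → Prov T Γ φ → Prov T (γ ∷ Γ) φ
  weaken γ Γ d = mpᴾ Γ (lift⊢ Γ (logax (ax-K _ _))) d

  ⇒-refl : ∀ φ → T ⊢ φ ⇒ φ
  ⇒-refl φ = mp (mp (logax (ax-S φ (φ ⇒ φ) φ)) (logax (ax-K _ _))) (logax (ax-K _ _))

  hypᴾ : ∀ Γ {φ} → φ ∈ Γ → Prov T Γ φ
  hypᴾ (γ ∷ Γ) (here refl) = lift⊢ Γ (⇒-refl γ)
  hypᴾ (γ ∷ Γ) (there p)   = weaken γ Γ (hypᴾ Γ p)

  cutᴾ : ∀ Γ Δ {φ} → All (Prov T Δ) Γ → Prov T Γ φ → Prov T Δ φ
  cutᴾ []      Δ []       d = lift⊢ Δ d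
  cutᴾ (γ ∷ Γ) Δ (p ∷ ps) d = mpᴾ Δ (cutᴾ Γ Δ ps d) p

  ⊆ᴾ : ∀ {Γ Δ φ} → Γ ⊆ Δ → Prov T Γ φ → Prov T Δ φ
  ⊆ᴾ {Γ} {Δ} s = cutᴾ Γ Δ (All.tabulate (λ p → hypᴾ Δ (s p)))

  dneᴾ : ∀ Γ {φ} → Prov T (¬' φ ∷ Γ) ⊥' → Prov T Γ φ
  dneᴾ Γ d = mpᴾ Γ (lift⊢ Γ (logax (ax-DN _))) d

  efqᴾ : ∀ Γ {φ} → Prov T Γ ⊥' → Prov T Γ φ
  efqᴾ Γ d = dneᴾ Γ (weaken _ Γ d)

  ¬⇒-left : ∀ Γ {φ ψ} → Prov T Γ (¬' (φ ⇒ ψ)) → Prov T Γ φ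
  ¬⇒-left Γ {φ} {ψ} d =
    dneᴾ Γ (mpᴾ Γ' (weaken _ Γ d)
      (efqᴾ (φ ∷ Γ') (mpᴾ (φ ∷ Γ') (hypᴾ (φ ∷ Γ') (there (here refl))) (hypᴾ (φ ∷ Γ') (here refl)))))
    where Γ' = ¬' φ ∷ Γ

  ¬⇒-right : ∀ Γ {φ ψ} → Prov T Γ (¬' (φ ⇒ ψ)) → Prov T Γ (¬' ψ)
  ¬⇒-right Γ {φ} {ψ} d =
    mpᴾ (ψ ∷ Γ) (weaken ψ Γ d) (weaken φ (ψ ∷ Γ) (hypᴾ (ψ ∷ Γ) (here refl)))

  gen₁ᴾ : ∀ Γ {φ} → T ⊢ List.map (ren suc id₂) Γ ⇛ φ → Prov T Γ (∀₁ φ)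
  gen₁ᴾ []      d = gen₁ d
  gen₁ᴾ (γ ∷ Γ) {φ} d =
    mpᴾ Γ (lift⊢ Γ (subst (λ γ' → T ⊢ ∀₁ (γ' ⇒ φ) ⇒ γ ⇒ ∀₁ φ) (ren1-ren suc γ) (logax (ax-∀₁d γ φ))))
      (gen₁ᴾ Γ d)

  gen₂ᴾ : ∀ k Γ {φ} → T ⊢ List.map (ren id (at k suc)) Γ ⇛ φ → Prov T Γ (∀₂ k φ)
  gen₂ᴾ k []      d = gen₂ d
  gen₂ᴾ k (γ ∷ Γ) {φ} d =
    mpᴾ Γ (lift⊢ Γ (subst (λ γ' → T ⊢ ∀₂ k (γ' ⇒ φ) ⇒ γ ⇒ ∀₂ k φ) (ren2-ren k suc γ) (logax (ax-∀₂d k γ φ))))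
      (gen₂ᴾ k Γ d)

-- Eigenvariables

bounds : List Fm → ℕ
bounds []      = 0
bounds (γ ∷ Γ) = bound γ ⊔ bounds Γ

free : ℕ → ℕ → ℕ
free y x = if does (x ≟ y) then 0 else suc x

free-< : ∀ y → free y ≗[ y ] suc
free-< y x p with does (x ≟ y) | proof (x ≟ y)
... | false | _        = refl
... | true  | ofʸ refl = Empty.⊥-elim (<-irrefl refl p)

free-inst : ∀ y → (free y ∘ inst y) ≗[ y ] id
free-inst y zero    _ with does (y ≟ y) | proof (y ≟ y)
... | true  | _     = refl
... | false | ofⁿ n = Empty.⊥-elim (n refl)
free-inst y (suc x) p = free-< y x (≤-trans (n≤1+n _) p)

ren-⇛ : ∀ {ρ σ} Γ {φ} → ren ρ σ (Γ ⇛ φ) ≡ List.map (ren ρ σ) Γ ⇛ ren ρ σ φ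
ren-⇛ []      = refl
ren-⇛ (γ ∷ Γ) = ren-⇛ Γ

map-ren-cong : ∀ Γ {n ρ ρ' σ σ'} → bounds Γ ≤ n → ρ ≗[ n ] ρ' → σ ≗₂[ n ] σ' →
               List.map (ren ρ σ) Γ ≡ List.map (ren ρ' σ') Γ
map-ren-cong []      b e f = refl
map-ren-cong (γ ∷ Γ) {n} b e f =
  cong₂ _∷_ (ren-cong γ (λ x p → e x (≤-trans p b₁)) (λ k i p q → f k i (≤-trans p b₁) (≤-trans q b₁)))
            (map-ren-cong Γ (≤-trans (m≤n⊔m (bound γ) _) b) e f)
  where b₁ : bound γ ≤ n
        b₁ = ≤-trans (m≤m⊔n _ _) b

at-≗ : ∀ k {n τ τ'} → τ ≗[ n ] τ' → at k τ ≗₂[ n ] at k τ'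
at-≗ k e j i _ q with does (j ≟ k)
... | true  = e i q
... | false = refl

module _ {T : Theory} where

  -- Since `y` is fresh for `Γ` and `φ`, renaming by `free y` shifts `Γ` and turns the instance back
  -- into `φ`, with `y` as the index to be bound.
  fresh₁ : ∀ Γ φ y → bounds Γ ≤ y → bound φ ≤ y → T ⊢ Γ ⇛ ren1 (inst y) φ → T ⊢ Γ ⇛ ∀₁ φ
  fresh₁ Γ φ y b c d =
    gen₁ᴾ Γ (subst₂ (λ Δ ψ → T ⊢ Δ ⇛ ψ) (map-ren-cong Γ b (free-< y) (λ _ _ _ _ → refl)) eq
      (subst (T ⊢_) (ren-⇛ Γ) (rename (Γ ⇛ ren1 (inst y) φ) (free y) id₂ d)))
    where
    eq : ren (free y) id₂ (ren1 (inst y) φ) ≡ φ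
    eq = trans (cong (ren _ _) (ren1-ren _ φ)) (trans (ren-∘ φ)
      (trans (ren-cong φ (λ x p → free-inst y x (≤-trans p c)) (λ _ _ _ _ → refl)) (ren-id φ)))

  fresh₂ : ∀ k Γ φ y → bounds Γ ≤ y → bound φ ≤ y → T ⊢ Γ ⇛ ren2 k (inst y) φ → T ⊢ Γ ⇛ ∀₂ k φ
  fresh₂ k Γ φ y b c d =
    gen₂ᴾ k Γ (subst₂ (λ Δ ψ → T ⊢ Δ ⇛ ψ) (map-ren-cong Γ b (λ _ _ → refl) (at-≗ k (free-< y))) eq
      (subst (T ⊢_) (ren-⇛ Γ) (rename (Γ ⇛ ren2 k (inst y) φ) id (at k (free y)) d)))
    where
    f : (at k (free y) ∘₂ at k (inst y)) ≗₂[ bound φ ] id₂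
    f j i _ q with does (j ≟ k)
    ... | true  = free-inst y i (≤-trans q c)
    ... | false = refl
    eq : ren id (at k (free y)) (ren2 k (inst y) φ) ≡ φ
    eq = trans (cong (ren _ _) (ren2-ren k _ φ)) (trans (ren-∘ φ)
      (trans (ren-cong φ (λ _ _ → refl) f) (ren-id φ)))

-- Models with an arbitrary proposition in place of falsity

Stable : Set → Set → Set
Stable ⊥ A = ((A → ⊥) → ⊥) → A

infixr 5 _∙_
_∙_ : {A : Set} → A → (ℕ → A) → ℕ → A
(a ∙ ρ) zero    = a
(a ∙ ρ) (suc n) = ρ n

push : {A : Set} → ℕ → A → (ℕ → ℕ → A) → ℕ → ℕ → A
push k r σ j = if does (j ≟ k) then r ∙ σ j else σ j

-- Henkin semantics: relation variables range over names in `R`, the same for all arities, and `_≈_`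
-- need not be identity.
record Structure : Set₁ where
  infix 7 _ε_ _≈_
  field
    D R Bot  : Set
    _ε_ _≈_  : D → D → Set
    app      : (k : ℕ) → R → Vec D k → Set
    ε-stable   : ∀ {x y} → Stable Bot (x ε y)
    ≈-stable   : ∀ {x y} → Stable Bot (x ≈ y)
    app-stable : ∀ {k r xs} → Stable Bot (app k r xs)

module Semantics (S : Structure) where
  open Structure S

  Sem : Fm → (ℕ → D) → (ℕ → ℕ → R) → Set
  Sem (mem x y)    ρ σ = ρ x ε ρ y
  Sem (eql x y)    ρ σ = ρ x ≈ ρ y
  Sem (rel k i xs) ρ σ = app k (σ k i) (map ρ xs)
  Sem ⊥'           ρ σ = Bot
  Sem (φ ⇒ ψ)      ρ σ = Sem φ ρ σ → Sem ψ ρ σ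
  Sem (∀₁ φ)       ρ σ = ∀ d → Sem φ (d ∙ ρ) σ
  Sem (∀₂ k φ)     ρ σ = ∀ r → Sem φ ρ (push k r σ)

  -- Formulas are built by implication and universal quantification only, and both preserve
  -- stability. This is what validates `ax-DN`.
  Sem-stable : ∀ φ ρ σ → Stable Bot (Sem φ ρ σ)
  Sem-stable (mem x y)    ρ σ n = ε-stable n
  Sem-stable (eql x y)    ρ σ n = ≈-stable n
  Sem-stable (rel k i xs) ρ σ n = app-stable n
  Sem-stable ⊥'           ρ σ n = n id
  Sem-stable (φ ⇒ ψ)      ρ σ n = λ a → Sem-stable ψ ρ σ (λ k → n (λ f → k (f a)))
  Sem-stable (∀₁ φ)       ρ σ n = λ d → Sem-stable φ _ σ (λ k → n (λ f → k (f d)))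
  Sem-stable (∀₂ j φ)     ρ σ n = λ r → Sem-stable φ ρ _ (λ k → n (λ f → k (f r)))

  Sem-ren : ∀ φ {r s ρ σ ρ' σ'} →
            (∀ x → ρ (r x) ≡ ρ' x) → (∀ k i → σ k (s k i) ≡ σ' k i) →
            (Sem (ren r s φ) ρ σ → Sem φ ρ' σ') × (Sem φ ρ' σ' → Sem (ren r s φ) ρ σ)
  Sem-ren (mem x y)    e f = subst₂ _ε_ (e x) (e y) , subst₂ _ε_ (sym (e x)) (sym (e y))
  Sem-ren (eql x y)    e f = subst₂ _≈_ (e x) (e y) , subst₂ _≈_ (sym (e x)) (sym (e y))
  Sem-ren (rel k i xs) {r} {ρ = ρ} {ρ' = ρ'} e f =
    subst₂ (app k) (f k i) eq , subst₂ (app k) (sym (f k i)) (sym eq)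
    where
    eq : map ρ (map r xs) ≡ map ρ' xs
    eq = trans (sym (map-∘ ρ r xs)) (map-cong e xs)
  Sem-ren ⊥'           e f = id , id
  Sem-ren (φ ⇒ ψ)      e f =
    let a , b = Sem-ren φ e f ; c , d = Sem-ren ψ e f
    in (λ g x → c (g (b x))) , (λ g x → d (g (a x)))
  Sem-ren (∀₁ φ) {r} {ρ = ρ} {ρ' = ρ'} e f =
    (λ g d → proj₁ (Sem-ren φ (e' d) f) (g d)) , (λ g d → proj₂ (Sem-ren φ (e' d) f) (g d))
    where
    e' : ∀ d x → (d ∙ ρ) (ext r x) ≡ (d ∙ ρ') x
    e' d zero    = refl
    e' d (suc x) = e x
  Sem-ren (∀₂ k φ) {s = s} {σ = σ} {σ' = σ'} e f =
    (λ g d → proj₁ (Sem-ren φ e (f' d)) (g d)) , (λ g d → proj₂ (Sem-ren φ e (f' d)) (g d))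
    where
    f' : ∀ d j i → push k d σ j (extAt k s j i) ≡ push k d σ' j i
    f' d j i with does (j ≟ k)
    f' d j i       | false = f j i
    f' d j zero    | true  = refl
    f' d j (suc i) | true  = f j i

-- Soundness is a field because the model of variables built below obtains it from its truth lemma.
-- The points serve as default environments.
record Model (T : Theory) : Set₁ where
  field structure : Structure
  open Structure structure public
  open Semantics structure public
  field
    point₁ : ℕ → D
    point₂ : ℕ → ℕ → R
    sound  : ∀ {χ} → T ⊢ χ → ∀ ρ σ → Sem χ ρ σ

-- Krivine's form of the completeness theorem.  Interpreting ⊥' by the
-- proposition "the hypotheses are inconsistent" makes the maximal theory
-- definable, and its properties provable, without excluded middle.
module Maximal (T : Theory) (χ : Fm) where

  henkin : List Fm → Fm → Fm
  henkin Γ (∀₁ φ)   = ren1 (inst (bounds (φ ∷ Γ))) φ ⇒ ∀₁ φ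
  henkin Γ (∀₂ k φ) = ren2 k (inst (bounds (φ ∷ Γ))) φ ⇒ ∀₂ k φ
  henkin Γ _        = ⊥' ⇒ ⊥'

  -- Refuting φ(y) ⇒ ∀φ proves both φ(y) and ¬∀φ; as y is fresh, the former gives ∀φ.
  henkin-conservative : ∀ Γ φ → Prov T (henkin Γ φ ∷ Γ) ⊥' → Prov T Γ ⊥'
  henkin-conservative Γ (mem x y)    d = mpᴾ Γ d (lift⊢ Γ (⇒-refl ⊥'))
  henkin-conservative Γ (eql x y)    d = mpᴾ Γ d (lift⊢ Γ (⇒-refl ⊥'))
  henkin-conservative Γ (rel k i xs) d = mpᴾ Γ d (lift⊢ Γ (⇒-refl ⊥'))
  henkin-conservative Γ ⊥'           d = mpᴾ Γ d (lift⊢ Γ (⇒-refl ⊥'))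
  henkin-conservative Γ (φ ⇒ ψ)      d = mpᴾ Γ d (lift⊢ Γ (⇒-refl ⊥'))
  henkin-conservative Γ (∀₁ φ)       d =
    mpᴾ Γ (¬⇒-right Γ d)
      (fresh₁ Γ φ _ (m≤n⊔m (bound φ) _) (m≤m⊔n _ _) (¬⇒-left Γ {ψ = ∀₁ φ} d))
  henkin-conservative Γ (∀₂ k φ)     d =
    mpᴾ Γ (¬⇒-right Γ d)
      (fresh₂ k Γ φ _ (m≤n⊔m (bound φ) _) (m≤m⊔n _ _) (¬⇒-left Γ {ψ = ∀₂ k φ} d))

  Henkin : ℕ → List Fm
  Henkin zero    = ¬' χ ∷ []
  Henkin (suc n) = henkin (Henkin n) (formula n) ∷ Henkin n

  Bot : Set
  Bot = Prov T (Henkin 0) ⊥'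

  Henkin-conservative : ∀ n → Prov T (Henkin n) ⊥' → Bot
  Henkin-conservative zero    d = d
  Henkin-conservative (suc n) d =
    Henkin-conservative n (henkin-conservative (Henkin n) (formula n) d)

  -- Lindenbaum's extension without deciding consistency: acceptance of `formula n` is a
  -- proposition, namely consistency relative to `Bot`.
  Stage : ℕ → Fm → Set
  Stage zero    ψ = Σ ℕ λ m → ψ ∈ Henkin m
  Stage (suc n) ψ =
    Stage n ψ ⊎ (ψ ≡ formula n × (∀ Δ → All (Stage n) Δ → Prov T (formula n ∷ Δ) ⊥' → Bot))

  Limit : Fm → Set
  Limit ψ = Σ ℕ λ n → Stage n ψ

  Henkin-mono : ∀ {m n ψ} → m ≤′ n → ψ ∈ Henkin m → ψ ∈ Henkin n
  Henkin-mono ≤′-refl     p = p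
  Henkin-mono (≤′-step l) p = there (Henkin-mono l p)

  Stage-mono : ∀ {m n ψ} → m ≤′ n → Stage m ψ → Stage n ψ
  Stage-mono ≤′-refl     p = p
  Stage-mono (≤′-step l) p = inj₁ (Stage-mono l p)

  directed : (Q : ℕ → Fm → Set) → (∀ {m n ψ} → m ≤′ n → Q m ψ → Q n ψ) →
             ∀ {Δ} → All (λ ψ → Σ ℕ λ n → Q n ψ) Δ → Σ ℕ λ n → All (Q n) Δ
  directed Q mono []             = 0 , []
  directed Q mono ((m , q) ∷ qs) =
    let n , rs = directed Q mono qs
    in m ⊔ n , mono (≤⇒≤′ (m≤m⊔n m n)) q ∷ All.map (mono (≤⇒≤′ (m≤n⊔m m n))) rs

  split : ∀ n {Δ} → All (Stage (suc n)) Δ →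
          All (Stage n) Δ ⊎
          ((∀ Δ → All (Stage n) Δ → Prov T (formula n ∷ Δ) ⊥' → Bot) ×
           Σ (List Fm) λ Δ' → All (Stage n) Δ' × Δ ⊆ (formula n ∷ Δ'))
  split n [] = inj₁ []
  split n (inj₁ p ∷ ps) with split n ps
  ... | inj₁ qs = inj₁ (p ∷ qs)
  ... | inj₂ (c , Δ' , qs , s) = inj₂ (c , _ ∷ Δ' , p ∷ qs , λ
    { (here e)  → there (here e)
    ; (there m) → case s m of λ { (here e) → here e ; (there m') → there (there m') } })
  split n (inj₂ (refl , c) ∷ ps) with split n ps
  ... | inj₁ qs = inj₂ (c , _ , qs , id)
  ... | inj₂ (_ , Δ' , qs , s) = inj₂ (c , Δ' , qs , λ { (here e) → here e ; (there m) → s m })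

  Stage-consistent : ∀ n {Δ} → All (Stage n) Δ → Prov T Δ ⊥' → Bot
  Stage-consistent zero ps d =
    let m , qs = directed (λ m ψ → ψ ∈ Henkin m) Henkin-mono ps
    in Henkin-conservative m (⊆ᴾ (All.lookup qs) d)
  Stage-consistent (suc n) ps d with split n ps
  ... | inj₁ qs               = Stage-consistent n qs d
  ... | inj₂ (c , Δ , qs , s) = c Δ qs (⊆ᴾ s d)

  True : Fm → Set
  True ψ = Σ (List Fm) λ Δ → All Limit Δ × Prov T Δ ψ

  True-consistent : True ⊥' → Bot
  True-consistent (Δ , ps , d) =
    let n , qs = directed Stage Stage-mono ps in Stage-consistent n qs d

  True-⊢ : ∀ {ψ} → T ⊢ ψ → True ψ
  True-⊢ d = [] , [] , d

  True-mp : ∀ {φ ψ} → True (φ ⇒ ψ) → True φ → True ψ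
  True-mp (Δ , ps , d) (Δ' , qs , e) =
    Δ ++ Δ' , ++⁺ ps qs , mpᴾ (Δ ++ Δ') (⊆ᴾ (xs⊆xs++ys Δ Δ') d) (⊆ᴾ (xs⊆ys++xs Δ' Δ) e)

  True-Limit : ∀ {ψ} → Limit ψ → True ψ
  True-Limit {ψ} p = ψ ∷ [] , p ∷ [] , hypᴾ (ψ ∷ []) (here refl)

  True-Bot : Bot → True ⊥'
  True-Bot d = Henkin 0 , All.tabulate (λ p → 0 , 0 , p) , d

  -- A refutation of `ψ` from formulas of stage `n` would make `¬' ψ` true; so, where `ψ` is
  -- `formula n`, it passes the test for stage `suc n`.
  True-maximal : ∀ {ψ} → (True (¬' ψ) → Bot) → True ψ
  True-maximal {ψ} c with formula-surjective ψ
  ... | n , refl = True-Limit (suc n , inj₂ (refl , λ Δ ps d → c (Δ , All.map (n ,_) ps , d)))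

  True-stable : ∀ {ψ} → Stable Bot (True ψ)
  True-stable n = True-maximal (λ t → n (λ u → True-consistent (True-mp t u)))

  True-⇒ : ∀ {φ ψ} → (True φ → True ψ) → True (φ ⇒ ψ)
  True-⇒ f = True-stable λ k →
    -- It suffices that `¬' φ` is true. By maximality it is, since `¬' (¬' φ)` would give `φ`, then
    -- `ψ`, then the implication that `k` excludes.
    k (True-mp (True-mp (True-⊢ (logax (ax-S _ _ _)))
        (True-mp (True-⊢ (logax (ax-K _ _))) (True-⊢ (efqᴾ (⊥' ∷ []) (⇒-refl ⊥')))))
      (True-maximal λ t → k (True-mp (True-⊢ (logax (ax-K _ _)))
        (f (True-mp (True-⊢ (logax (ax-DN _))) t)))))

  -- The hypothesis is used at the witness variable chosen when `∀₁ φ` came up in the enumeration.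
  True-∀₁ : ∀ {φ} → (∀ y → True (ren1 (inst y) φ)) → True (∀₁ φ)
  True-∀₁ {φ} f with formula-surjective (∀₁ φ)
  ... | n , e = True-mp (True-Limit (0 , suc n , here (cong (henkin (Henkin n)) (sym e)))) (f _)

  True-∀₂ : ∀ {k φ} → (∀ i → True (ren2 k (inst i) φ)) → True (∀₂ k φ)
  True-∀₂ {k} {φ} f with formula-surjective (∀₂ k φ)
  ... | n , e = True-mp (True-Limit (0 , suc n , here (cong (henkin (Henkin n)) (sym e)))) (f _)

  structure : Structure
  structure = record
    { D = ℕ ; R = ℕ ; Bot = Bot
    ; _ε_ = λ x y → True (mem x y)
    ; _≈_ = λ x y → True (eql x y)
    ; app = λ k r xs → True (rel k r xs)
    ; ε-stable = True-stable ; ≈-stable = True-stable ; app-stable = True-stable }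

  open Semantics structure

  inst-ren₁ : ∀ φ d ρ σ → ren1 (inst d) (ren (ext ρ) σ φ) ≡ ren (d ∙ ρ) σ φ
  inst-ren₁ φ d ρ σ =
    trans (ren1-ren _ _) (trans (ren-∘ φ) (ren-≗ φ (λ { zero → refl ; (suc x) → refl }) (λ _ _ → refl)))

  inst-ren₂ : ∀ φ k r ρ σ → ren2 k (inst r) (ren ρ (extAt k σ) φ) ≡ ren ρ (push k r σ) φ
  inst-ren₂ φ k r ρ σ =
    trans (ren2-ren k _ _) (trans (ren-∘ φ) (ren-≗ φ (λ _ → refl) f))
    where
    f : ∀ j i → at k (inst r) j (extAt k σ j i) ≡ push k r σ j i
    f j i with does (j ≟ k)
    f j i       | false = refl
    f j zero    | true  = refl
    f j (suc i) | true  = refl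

  truth : ∀ φ ρ σ → (Sem φ ρ σ → True (ren ρ σ φ)) × (True (ren ρ σ φ) → Sem φ ρ σ)
  truth (mem x y)    ρ σ = id , id
  truth (eql x y)    ρ σ = id , id
  truth (rel k i xs) ρ σ = id , id
  truth ⊥'           ρ σ = True-Bot , True-consistent
  truth (φ ⇒ ψ)      ρ σ =
    let a , b = truth φ ρ σ ; c , d = truth ψ ρ σ
    in (λ f → True-⇒ (λ t → c (f (b t)))) , (λ t s → d (True-mp t (a s)))
  truth (∀₁ φ)       ρ σ =
    (λ f → True-∀₁ (λ d → subst True (sym (inst-ren₁ φ d ρ σ)) (proj₁ (truth φ (d ∙ ρ) σ) (f d)))) ,
    (λ t d → proj₂ (truth φ (d ∙ ρ) σ)
      (subst True (inst-ren₁ φ d ρ σ) (True-mp (True-⊢ (logax (ax-∀₁e _ d))) t)))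
  truth (∀₂ k φ)     ρ σ =
    (λ f → True-∀₂ (λ r → subst True (sym (inst-ren₂ φ k r ρ σ)) (proj₁ (truth φ ρ (push k r σ)) (f r)))) ,
    (λ t r → proj₂ (truth φ ρ (push k r σ))
      (subst True (inst-ren₂ φ k r ρ σ) (True-mp (True-⊢ (logax (ax-∀₂e k _ r))) t)))

  model : Model T
  model = record
    { structure = structure
    ; point₁ = id ; point₂ = id₂
    ; sound = λ {χ'} d ρ σ → proj₂ (truth χ' ρ σ) (True-⊢ (rename χ' ρ σ d)) }

  -- `χ` would be true together with `¬' χ`, which gives `Bot`; and `Bot` unfolds to a derivation of
  -- `¬' (¬' χ)`.
  refutes : Sem χ id id₂ → T ⊢ χ
  refutes s = mp (logax (ax-DN χ)) (True-consistent (True-mp (True-Limit (0 , 0 , here refl))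
    (subst True (ren-id χ) (proj₁ (truth χ id id₂) s))))

completeness : ∀ {T χ} → ((M : Model T) → let open Model M in ∀ ρ σ → Sem χ ρ σ) → T ⊢ χ
completeness {T} {χ} v = Maximal.refutes T χ (v (Maximal.model T χ) id id₂)

-- Restriction to helow sets

ren-ʰ : ∀ φ {ρ σ} → ren ρ σ φ ʰ ≡ ren ρ σ (φ ʰ)
ren-ʰ (mem x y)    = refl
ren-ʰ (eql x y)    = refl
ren-ʰ (rel k i xs) = refl
ren-ʰ ⊥'           = refl
ren-ʰ (φ ⇒ ψ)      = cong₂ _⇒_ (ren-ʰ φ) (ren-ʰ ψ)
-- Only index 0 is free in `Helow₀` and `ext ρ` fixes it, so the renamed `Helow₀` computes to
-- itself.
ren-ʰ (∀₁ φ)       = cong (λ ψ → ∀₁ (Helow₀ ⇒ ψ)) (ren-ʰ φ)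
ren-ʰ (∀₂ k φ)     = cong (∀₂ k) (ren-ʰ φ)

ren1-ʰ : ∀ ρ φ → ren1 ρ φ ʰ ≡ ren ρ id₂ (φ ʰ)
ren1-ʰ ρ φ = trans (cong _ʰ (ren1-ren ρ φ)) (ren-ʰ φ)

ren2-ʰ : ∀ k τ φ → ren2 k τ φ ʰ ≡ ren id (at k τ) (φ ʰ)
ren2-ʰ k τ φ = trans (cong _ʰ (ren2-ren k τ φ)) (ren-ʰ φ)

module Interpretation {T : Theory} (M : Model T) where
  open Model M

  -- Only index 0 is free in Helow₀, so this is definitionally equal to the
  -- interpretation of Helow₀ in every environment starting with a.
  Hl : D → Set
  Hl a = Sem Helow₀ (a ∙ point₁) point₂

  -- `ax-leib` speaks of variables, so `d` and `d'` are made the values of indices 0 and 1 and the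
  -- parameters of `φ` are moved past them.
  leibniz : ∀ φ {d d' ρ σ} → d ≈ d' → Sem φ (d ∙ ρ) σ → Sem φ (d' ∙ ρ) σ
  leibniz φ {d} {d'} {ρ} {σ} e s =
    proj₁ (Sem-ren φ (λ { zero → refl ; (suc x) → refl }) (λ _ _ → refl))
      (subst (λ χ → Sem χ ρ'' σ) (eq 1)
        (sound (logax (ax-leib 0 1 φ'')) ρ'' σ e
          (subst (λ χ → Sem χ ρ'' σ) (sym (eq 0))
            (proj₂ (Sem-ren φ (λ { zero → refl ; (suc x) → refl }) (λ _ _ → refl)) s))))
    where
    ρ'' = d ∙ d' ∙ ρ
    shift2 = ext (λ x → suc (suc x))
    φ'' = ren shift2 id₂ φ
    eq : ∀ y → ren1 (inst y) φ'' ≡ ren (inst y ∘ shift2) id₂ φ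
    eq y = trans (ren1-ren (inst y) φ'') (ren-∘ φ)

  relativize-∀ⁿ : ∀ k χ ρ σ → Sem (∀₁ⁿ k (χ ʰ)) ρ σ → Sem (∀₁ⁿ k χ ʰ) ρ σ
  relativize-∀ⁿ zero    χ ρ σ s = s
  relativize-∀ⁿ (suc k) χ ρ σ s = λ d _ → relativize-∀ⁿ k χ (d ∙ ρ) σ (s d)

  push-at : ∀ k (r : R) σ j i → push k r σ j (at k suc j i) ≡ σ j i
  push-at k r σ j i with does (j ≟ k)
  ... | true  = refl
  ... | false = refl

  inst-∙ : ∀ (ρ : ℕ → D) y x → ρ (inst y x) ≡ (ρ y ∙ ρ) x
  inst-∙ ρ y zero    = refl
  inst-∙ ρ y (suc x) = refl

  inst-push : ∀ k r (σ : ℕ → ℕ → R) j i → σ j (at k (inst r) j i) ≡ push k (σ k r) σ j i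
  inst-push k r σ j i with does (j ≟ k) | proof (j ≟ k)
  inst-push k r σ j i       | false | _        = refl
  inst-push k r σ j zero    | true  | ofʸ refl = refl
  inst-push k r σ j (suc i) | true  | ofʸ refl = refl

  module _ {U : Theory} (axioms : ∀ {φ} → U φ → ∀ ρ σ → Sem (φ ʰ) ρ σ) where

    -- Instantiating a restricted quantifier at a variable requires its value to be helow, whence
    -- the condition on `ρ`.
    logic-ʰ : ∀ {φ} → LogAx φ → ∀ ρ σ → (∀ x → Hl (ρ x)) → Sem (φ ʰ) ρ σ
    logic-ʰ (ax-K φ ψ)      ρ σ h = λ a _ → a
    logic-ʰ (ax-S φ ψ χ)    ρ σ h = λ f g a → f a (g a)
    logic-ʰ (ax-DN φ)       ρ σ h = Sem-stable (φ ʰ) ρ σ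
    logic-ʰ (ax-∀₁e φ y)    ρ σ h = λ f →
      subst (λ χ → Sem χ ρ σ) (sym (ren1-ʰ (inst y) φ))
        (proj₂ (Sem-ren (φ ʰ) (inst-∙ ρ y) (λ _ _ → refl)) (f (ρ y) (h y)))
    logic-ʰ (ax-∀₁d φ ψ)    ρ σ h = λ f a d hd → f d hd
      (subst (λ χ → Sem χ (d ∙ ρ) σ) (sym (ren1-ʰ suc φ))
        (proj₂ (Sem-ren (φ ʰ) (λ _ → refl) (λ _ _ → refl)) a))
    logic-ʰ (ax-∀₂e k φ i)  ρ σ h = λ f →
      subst (λ χ → Sem χ ρ σ) (sym (ren2-ʰ k (inst i) φ))
        (proj₂ (Sem-ren (φ ʰ) (λ _ → refl) (inst-push k i σ)) (f (σ k i)))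
    logic-ʰ (ax-∀₂d k φ ψ)  ρ σ h = λ f a r → f r
      (subst (λ χ → Sem χ ρ (push k r σ)) (sym (ren2-ʰ k suc φ))
        (proj₂ (Sem-ren (φ ʰ) (λ _ → refl) (push-at k r σ)) a))
    logic-ʰ (ax-refl x)     ρ σ h = sound (logax (ax-refl x)) ρ σ
    logic-ʰ (ax-leib x y φ) ρ σ h = λ e a →
      subst (λ χ → Sem χ ρ σ) (sym (ren1-ʰ (inst y) φ))
        (proj₂ (Sem-ren (φ ʰ) (inst-∙ ρ y) (λ _ _ → refl))
          (leibniz (φ ʰ) e
            (proj₁ (Sem-ren (φ ʰ) (inst-∙ ρ x) (λ _ _ → refl))
              (subst (λ χ → Sem χ ρ σ) (ren1-ʰ (inst x) φ) a))))
    -- Relation quantifiers are not restricted: the relation that Comprehension gives for `ψ ʰ` on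
    -- all sets serves on the helow ones.
    logic-ʰ (ax-comp k ψ)   ρ σ h = λ n →
      sound (logax (ax-comp k (ψ ʰ))) ρ σ λ r s → n r
        (relativize-∀ⁿ k _ ρ (push k r σ)
          (subst (λ χ → Sem (∀₁ⁿ k (rel k 0 _ ⇔' χ)) ρ (push k r σ))
            (trans (ren2-ren k suc (ψ ʰ)) (sym (ren2-ʰ k suc ψ))) s))

    sound-ʰ : ∀ {φ} → U ⊢ φ → ∀ ρ σ → (∀ x → Hl (ρ x)) → Sem (φ ʰ) ρ σ
    sound-ʰ (logax a)  ρ σ h = logic-ʰ a ρ σ h
    sound-ʰ (hyp u)    ρ σ h = axioms u ρ σ
    sound-ʰ (mp d e)   ρ σ h = sound-ʰ d ρ σ h (sound-ʰ e ρ σ h)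
    sound-ʰ (gen₁ d)   ρ σ h = λ x hx → sound-ʰ d (x ∙ ρ) σ λ { zero → hx ; (suc y) → h y }
    sound-ʰ (gen₂ d)   ρ σ h = λ r → sound-ʰ d ρ _ h

  -- Carries a sentence from an environment of helow sets, where `sound-ʰ` applies, to an arbitrary
  -- one.
  Sem-local : ∀ φ {n b} ρ ρ' σ → Bnd n b φ → (∀ x → x < n → ρ x ≡ ρ' x) →
              (Sem (φ ʰ) ρ σ → Sem (φ ʰ) ρ' σ) × (Sem (φ ʰ) ρ' σ → Sem (φ ʰ) ρ σ)
  Sem-local (mem x y) ρ ρ' σ (p , q) e =
    subst₂ _ε_ (e x p) (e y q) , subst₂ _ε_ (sym (e x p)) (sym (e y q))
  Sem-local (eql x y) ρ ρ' σ (p , q) e =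
    subst₂ _≈_ (e x p) (e y q) , subst₂ _≈_ (sym (e x p)) (sym (e y q))
  Sem-local (rel k i xs) {n} ρ ρ' σ (_ , ps) e =
    subst (app k (σ k i)) (eq ps) , subst (app k (σ k i)) (sym (eq ps))
    where
    eq : ∀ {k} {xs : Vec ℕ k} → VecAll (_< n) xs → map ρ xs ≡ map ρ' xs
    eq []       = refl
    eq (p ∷ ps) = cong₂ _∷_ (e _ p) (eq ps)
  Sem-local ⊥' ρ ρ' σ _ e = id , id
  Sem-local (φ ⇒ ψ) ρ ρ' σ (p , q) e =
    let a , b = Sem-local φ ρ ρ' σ p e ; c , d = Sem-local ψ ρ ρ' σ q e
    in (λ f s → c (f (b s))) , (λ f s → d (f (a s)))
  Sem-local (∀₁ φ) {n} ρ ρ' σ p e =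
    (λ f d h → proj₁ (Sem-local φ _ _ σ p (e' d)) (f d h)) ,
    (λ f d h → proj₂ (Sem-local φ _ _ σ p (e' d)) (f d h))
    where
    e' : ∀ d x → x < suc n → (d ∙ ρ) x ≡ (d ∙ ρ') x
    e' d zero    _       = refl
    e' d (suc x) (s≤s q) = e x q
  Sem-local (∀₂ k φ) ρ ρ' σ p e =
    (λ f r → proj₁ (Sem-local φ ρ ρ' _ p e) (f r)) ,
    (λ f r → proj₂ (Sem-local φ ρ ρ' _ p e) (f r))

-- Set theory in a model of BLT

module Sets {T : Theory} (M : Model T) (BLT⊆T : ∀ {φ} → BLT φ → T φ) where
  open Model M
  open Interpretation M

  infix  7 _⊑_ _co⊑_
  infix  6 ¬_
  infixr 5 _∧_
  infixr 4 _∨_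
  infix  3 _⇔_

  ¬_ : Set → Set
  ¬ A = A → Bot

  -- These connectives agree by computation with the interpretations of the defined ones, so that
  -- the axioms can be used in a model as they stand.
  ∃ : (D → Set) → Set
  ∃ P = ((x : D) → P x → Bot) → Bot

  _∧_ _∨_ _⇔_ : Set → Set → Set
  A ∧ B = (A → B → Bot) → Bot
  A ∨ B = (A → Bot) → B
  A ⇔ B = (A → B) ∧ (B → A)

  record St (A : Set) : Set where
    constructor st
    field stable : Stable Bot A
  open St

  instance
    St-Bot : St Bot
    St-Bot = st (λ n → n id)
    St-ε : ∀ {x y} → St (x ε y)
    St-ε = st ε-stable
    St-≈ : ∀ {x y} → St (x ≈ y)
    St-≈ = st ≈-stable
    St-app : ∀ {k r xs} → St (app k r xs)
    St-app = st app-stable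
    St-Π : {A : Set} {B : A → Set} {{_ : ∀ {a} → St (B a)}} → St ((a : A) → B a)
    St-Π {{s}} = st (λ n a → stable s (λ k → n (λ f → k (f a))))

  by-contra : {A : Set} {{_ : St A}} → ((A → Bot) → Bot) → A
  by-contra {{s}} = stable s

  absurd : {A : Set} {{_ : St A}} → Bot → A
  absurd b = by-contra (λ _ → b)

  em : {C : Set} (A : Set) {{_ : St C}} → (A → C) → (¬ A → C) → C
  em A f g = by-contra (λ k → k (g (λ a → k (f a))))

  -- Eliminates both ∃ and ∧: each is the double negation of a Σ-type.
  _>>=_ : {A C : Set} {B : A → Set} {{_ : St C}} →
          (((a : A) → B a → Bot) → Bot) → (Σ A B → C) → C
  m >>= f = by-contra (λ k → m (λ a b → k (f (a , b))))

  ⟨_,_⟩ : {A : Set} {B : A → Set} (a : A) → B a → ((a : A) → B a → Bot) → Bot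
  ⟨ a , b ⟩ k = k a b

  either : {A B C : Set} {{_ : St C}} → A ∨ B → (A → C) → (B → C) → C
  either {A} d f g = em A f (λ na → g (d na))

  left : {A B : Set} {{_ : St B}} → A → A ∨ B
  left a na = absurd (na a)

  right : {A B : Set} → B → A ∨ B
  right b _ = b

  fst : {A B : Set} {{_ : St A}} → A ∧ B → A
  fst p = p >>= proj₁

  snd : {A B : Set} {{_ : St B}} → A ∧ B → B
  snd p = p >>= proj₂

  _⊑_ _co⊑_ : D → D → Set
  x ⊑ y   = ∀ z → z ε x → z ε y
  x co⊑ y = ∀ z → ¬ z ε x → z ε y

  ⊑-refl : ∀ {x} → x ⊑ x
  ⊑-refl z p = p

  Low : D → Set
  Low x = ¬ x ε x

  BLev : D → Set
  BLev l = Sem (BLevel 0 (dp 1 0 0)) (l ∙ point₁) point₂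

  axiom : ∀ {φ} → BLT φ → Sem φ point₁ point₂
  axiom p = sound (hyp (BLT⊆T p)) point₁ point₂

  ≈-refl : ∀ {x} → x ≈ x
  ≈-refl {x} = sound (logax (ax-refl 0)) (x ∙ point₁) point₂

  ≈-sym : ∀ {x y} → x ≈ y → y ≈ x
  ≈-sym {x} e = leibniz (eql 0 1) {ρ = x ∙ point₁} {σ = point₂} e ≈-refl

  ≈-ε : ∀ {x y a} → x ≈ y → x ε a → y ε a
  ≈-ε {a = a} = leibniz (mem 0 1) {ρ = a ∙ point₁} {σ = point₂}

  extensionality : ∀ a b → (∀ x → x ε a ⇔ x ε b) → a ≈ b
  extensionality = axiom (here refl)

  record IsSep (ψ : Fm) (ρ : ℕ → D) (σ : ℕ → ℕ → R) (a b : D) : Set where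
    field
      low   : Low b
      sub   : b ⊑ a
      prop  : ∀ {x} → x ε b → Sem ψ (x ∙ ρ) σ
      intro : ∀ {x} → x ε a → Sem ψ (x ∙ ρ) σ → x ε b
  open IsSep

  unfold-⇔ : ∀ ψ {ρ σ A} {{_ : St A}} → A ⇔ Sem ψ ρ σ → (A → Sem ψ ρ σ) × (Sem ψ ρ σ → A)
  unfold-⇔ ψ p = fst {{St-Π {{st (Sem-stable ψ _ _)}}}} p , snd p

  shift-ren : ∀ k ψ ρ σ r → (Sem (ren2 k suc ψ) ρ (push k r σ) → Sem ψ ρ σ) ×
                            (Sem ψ ρ σ → Sem (ren2 k suc ψ) ρ (push k r σ))
  shift-ren k ψ ρ σ r =
    subst (λ χ → (Sem χ ρ (push k r σ) → Sem ψ ρ σ) × (Sem ψ ρ σ → Sem χ ρ (push k r σ)))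
      (sym (ren2-ren k suc ψ)) (Sem-ren ψ (λ _ → refl) (push-at k r σ))

  comprehend₁ : ∀ ψ ρ σ → ((r : R) → (∀ x → (app 1 r (x ∷ []) → Sem ψ (x ∙ ρ) σ) ×
                                            (Sem ψ (x ∙ ρ) σ → app 1 r (x ∷ []))) → Bot) → Bot
  comprehend₁ ψ ρ σ k = sound (logax (ax-comp 1 ψ)) ρ σ λ r f → k r λ x →
    let a , b = unfold-⇔ (ren2 1 suc ψ) (f x) ; c , d = shift-ren 1 ψ (x ∙ ρ) σ r
    in (λ p → c (a p)) , (λ s → b (d s))

  -- In an instance of Comprehension the first argument is bound innermost.
  comprehend₂ : ∀ ψ ρ σ → ((r : R) → (∀ x y → (app 2 r (x ∷ y ∷ []) → Sem ψ (x ∙ y ∙ ρ) σ) ×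
                                              (Sem ψ (x ∙ y ∙ ρ) σ → app 2 r (x ∷ y ∷ []))) → Bot) → Bot
  comprehend₂ ψ ρ σ k = sound (logax (ax-comp 2 ψ)) ρ σ λ r f → k r λ x y →
    let a , b = unfold-⇔ (ren2 2 suc ψ) (f y x) ; c , d = shift-ren 2 ψ (x ∙ y ∙ ρ) σ r
    in (λ p → c (a p)) , (λ s → b (d s))

  -- Builders refer to variables by levels, so in a formula of depth n
  -- interpreted in x ∙ ρ the level of x is n - 1 and that of ρ 0 is n - 2.
  separate : ∀ ψ ρ σ {a} → Low a → ∃ λ b → IsSep ψ ρ σ a b
  separate ψ ρ σ {a} la = do
    (F , f) ← comprehend₁ ψ ρ σ
    (b , p) ← axiom (there (there (here refl))) F a la
    (lb , q) ← p
    ⟨ b , record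
      { low = lb
      ; sub = λ x xb → snd (fst (q x) xb)
      ; prop = λ {x} xb → proj₁ (f x) (fst (fst (q x) xb))
      ; intro = λ {x} xa s → snd (q x) ⟨ proj₂ (f x) s , xa ⟩ } ⟩

  Hl-below : ∀ {a b} → b ⊑ a → Hl a → Hl b
  Hl-below b⊑a h = do
    (c , p) ← h
    (t , q) ← p
    (a⊑c , l) ← q
    ⟨ c , ⟨ t , ⟨ (λ z zb → a⊑c z (b⊑a z zb)) , l ⟩ ⟩ ⟩

  Hl-member : ∀ {a b} → b ε a → Hl a → Hl b
  Hl-member {b = b} ba h = do
    (c , p) ← h
    (t , q) ← p
    (a⊑c , l) ← q
    ⟨ c , ⟨ t , ⟨ t b (a⊑c b ba) , l ⟩ ⟩ ⟩

  Hl-low : ∀ {a} → Hl a → Low a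
  Hl-low {a} h aa = do
    (c , p) ← h
    (t , q) ← p
    (a⊑c , l) ← q
    l a (a⊑c a aa) aa

  Hl-transitive : ∀ {c} → (∀ y → y ε c → y ⊑ c) → (∀ x → x ε c → Hl x) → Hl c
  Hl-transitive {c} t l = ⟨ c , ⟨ t , ⟨ ⊑-refl , (λ x xc → Hl-low (l x xc)) ⟩ ⟩ ⟩

  -- Boolean-histories and boolean-levels

  Near : D → D → Set
  Near z d = z ⊑ d ∨ z co⊑ d

  -- bpot takes account of low sets only, so discarding the self-membered members of a
  -- boolean-history changes none of its values. `m-out` and `m-into` say that c = bpot(c ∩ H).
  record Hist (H : D) : Set where
    field
      H-low  : Low H
      m-low  : ∀ {d} → d ε H → Low d
      m-out  : ∀ {c z} → c ε H → z ε c → ∃ λ d → d ε c × d ε H × Near z d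
      m-into : ∀ {c z d} → c ε H → d ε c → d ε H → Near z d → z ε c

  record Lev (H s : D) : Set where
    field
      hist : Hist H
      out  : ∀ {z} → z ε s → ∃ λ d → d ε H × Near z d
      into : ∀ {z d} → d ε H → Near z d → z ε s
    open Hist hist public

  BLev-Lev : ∀ {s} → BLev s → ∃ λ H → Lev H s
  BLev-Lev l = do
    (h , p) ← l
    (bh , q) ← p
    (lh , f) ← bh
    (H , S) ← separate (¬' (mem 0 0)) point₁ point₂ lh
    ⟨ H , record
      { hist = record
        { H-low = low S
        ; m-low = prop S
        ; m-out = λ {c} {z} cH zc → do
            (d , r) ← fst (f c (sub S c cH) z) zc
            (dc , r) ← r
            (dh , r) ← r
            (ld , n) ← r
            ⟨ d , (dc , intro S dh ld , n) ⟩
        ; m-into = λ {c} {z} {d} cH dc dH n →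
            snd (f c (sub S c cH) z) ⟨ d , ⟨ dc , ⟨ sub S d dH , ⟨ prop S dH , n ⟩ ⟩ ⟩ ⟩ }
      ; out = λ {z} zs → do
          (d , r) ← fst (q z) zs
          (dh , r) ← r
          (ld , n) ← r
          ⟨ d , (intro S dh ld , n) ⟩
      ; into = λ {z} {d} dH n → snd (q z) ⟨ d , ⟨ sub S d dH , ⟨ prop S dH , n ⟩ ⟩ ⟩ } ⟩

  module _ {H : D} (hH : Hist H) where
    open Hist hH

    -- Russell's set of the intersection of G is missed by some member of G,
    -- and that member is minimal.
    minimal : ∀ {G c} → G ⊑ H → c ε G → ∃ λ a → a ε G × (∀ d → d ε a → ¬ d ε G)
    minimal {G} {c} G⊑H cG k = do
      (b , s) ← separate (((1 ∉ᵇ 1) ∧ᵇ ∀∈ 0 (λ a → 1 ∈ᵇ a)) (dp 2 0 0)) (G ∙ point₁) point₂ (m-low (G⊑H c cG))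
      -- A member `d` of both `a` and `G` includes `b`, which puts `b` into `a`; so an `a` that
      -- misses `b` would be minimal.
      let b∈ : ∀ a → a ε G → b ε a
          b∈ a aG = by-contra λ ba → k a (aG , λ d da dG →
            ba (m-into (G⊑H a aG) da (G⊑H d dG) (left λ z zb → snd (prop s zb) d dG)))
      low s (intro s (b∈ c cG) ⟨ low s , b∈ ⟩)

    -- Take `d` minimal. Being low, `x` lies in `d`, so it is near some `e` in `d`. Minimality
    -- excludes `x co⊑ e`; and `d`, being low, lies in `x`, so `x ⊑ e` would put `d` into `e`.
    not-co⊑ : ∀ {x d} → Low x → d ε H → ¬ x co⊑ d
    not-co⊑ {x} lx dH x̄d = do
      (G , s) ← separate (compl⊆ᵇ 0 1 (dp 2 0 0)) (x ∙ point₁) point₂ H-low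
      (d , (dG , min)) ← minimal (sub s) (intro s dH x̄d)
      let dH = sub s d dG
          x̄d = prop s dG
      (e , (ed , eH , n)) ← m-out dH (x̄d x lx)
      either n
        (λ xe → do
          let de = em (d ε x) (xe d) (λ dx → absurd (m-low dH (x̄d d dx)))
          -- Now `d` and `e` are members of each other, so none of the members of `H` containing one
          -- of them is minimal.
          (G' , s') ← separate ((1 ∈ᵇ 2 ∨ᵇ 0 ∈ᵇ 2) (dp 3 0 0)) (d ∙ e ∙ point₁) point₂ H-low
          (a , (aG , min')) ← minimal (sub s') (intro s' eH (left de))
          either (prop s' aG)
            (λ da → min' d da (intro s' dH (right ed)))
            (λ ea → min' e ea (intro s' eH (left de))))
        (λ x̄e → min e ed (intro s eH x̄e))

    m-low-out : ∀ {c z} → c ε H → z ε c → Low z → ∃ λ d → d ε c × d ε H × z ⊑ d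
    m-low-out cH zc lz = do
      (d , (dc , dH , n)) ← m-out cH zc
      ⟨ d , (dc , dH , either n id (λ z̄d → absurd (not-co⊑ lz dH z̄d))) ⟩

    -- In a minimal counterexample `a` with `x` in `e` in `a`, `x` is near some `f` in `e`.
    -- Minimality gives `f ⊑ e`, hence `f` is in `a`, and then so is `x`.
    m-transitive : ∀ {d e} → d ε H → e ε d → e ε H → e ⊑ d
    m-transitive {d} {e} dH ed eH = by-contra λ k → do
      (G , s) ← separate (¬' (∀ᵇ (λ e → e ∈ᵇ 1 ⇒ᵇ e ∈ᵇ 0 ⇒ᵇ e ⊆ᵇ 1) (dp 2 0 0))) (H ∙ point₁) point₂ H-low
      (a , (aG , min)) ← minimal (sub s) (intro s dH (λ t → k (t e ed eH)))
      let aH = sub s a aG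
      prop s aG λ e ea eH x xe → do
        (f , (fe , fH , n)) ← m-out eH xe
        let e-trans = by-contra λ k → min e ea (intro s eH k)
        m-into aH (m-into aH ea eH (left (e-trans f fe fH))) fH n

  module _ {H s : D} (L : Lev H s) where
    open Lev L

    member-ε : ∀ {d} → d ε H → d ε s
    member-ε dH = into dH (left ⊑-refl)

    member-⊑ : ∀ {d} → d ε H → d ⊑ s
    member-⊑ dH x xd = do
      (e , (_ , eH , n)) ← m-out dH xd
      into eH n

    low-out : ∀ {z} → z ε s → Low z → ∃ λ d → d ε H × z ⊑ d
    low-out zs lz = do
      (d , (dH , n)) ← out zs
      ⟨ d , (dH , either n id (λ z̄d → absurd (not-co⊑ hist lz dH z̄d))) ⟩

    Lev-low : Low s
    Lev-low ss = do
      (d , (dH , n)) ← out ss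
      either n
        (λ s⊑d → m-low dH (s⊑d d (member-ε dH)))
        (λ s̄⊑d → do
          -- If `H` is not in `s`, it is in `d` and hence in `s` after all. As `H` is low, some
          -- member `e` of `H` then includes `H`, so `e` is in `e`.
          let Hs = em (H ε s) id (λ Hs → member-⊑ dH H (s̄⊑d H Hs))
          (e , (eH , H⊑e)) ← low-out Hs H-low
          m-low eH (H⊑e e eH))

    Lev-below : ∀ {y z} → z ε s → Low z → y ⊑ z → y ε s
    Lev-below zs lz y⊑z = do
      (d , (dH , z⊑d)) ← low-out zs lz
      into dH (left λ x xy → z⊑d x (y⊑z x xy))

    Lev-transitive : ∀ {z} → z ε s → Low z → z ⊑ s
    Lev-transitive zs lz x xz = do
      (d , (dH , z⊑d)) ← low-out zs lz
      member-⊑ dH x (z⊑d x xz)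

  -- Helow parts of boolean-levels

  Core : D → D → Set
  Core = IsSep Helow₀ point₁ point₂

  core : ∀ {s} → Low s → ∃ λ t → Core s t
  core = separate Helow₀ point₁ point₂

  Hl-core : ∀ {H s t} → Lev H s → Core s t → Hl t
  Hl-core L C = Hl-transitive
    (λ y yt x xy → intro C (Lev-transitive L (sub C y yt) (Hl-low (prop C yt)) x xy)
                           (Hl-member xy (prop C yt)))
    (λ x xt → prop C xt)

  Hl-m-core : ∀ {H d t} → Hist H → d ε H → Core d t → Hl t
  Hl-m-core hH dH C = Hl-transitive
    (λ y yt x xy → do
      (e , (ed , eH , y⊑e)) ← m-low-out hH dH (sub C y yt) (Hl-low (prop C yt))
      intro C (m-transitive hH dH ed eH x (y⊑e x xy)) (Hl-member xy (prop C yt)))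
    (λ x xt → prop C xt)

  stratify : ∀ {a} → Low a → ∃ λ s → BLev s × a ⊑ s
  stratify {a} la = do
    (s , p) ← axiom (there (there (there (here refl)))) a la
    (l , q) ← p
    ⟨ s , (l , q) ⟩

  -- No transitive closure is formed: `a` is included in the core of a boolean-level.
  Hl-intro : ∀ {a} → Low a → (∀ x → x ε a → Hl x) → Hl a
  Hl-intro la h = do
    (s , (l , a⊑s)) ← stratify la
    (H , L) ← BLev-Lev l
    (t , C) ← core (Lev-low L)
    Hl-below (λ x xa → intro C (a⊑s x xa) (h x xa)) (Hl-core L C)

  Hl-exists : ∃ Hl
  Hl-exists = do
    (a , la) ← low-exists
    (e , E) ← separate ⊥' point₁ point₂ la
    ⟨ e , Hl-intro (low E) (λ x xe → absurd (prop E xe)) ⟩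
    where
    -- A set or its complement is not a member of itself.
    low-exists : ∃ Low
    low-exists = do
      (c , p) ← axiom (there (here refl)) (point₁ 0)
      (_ , q) ← p
      em (Low (point₁ 0)) (λ l → ⟨ point₁ 0 , l ⟩) (λ n → ⟨ c , (λ cc → n (snd q cc)) ⟩)

  _⊑ʰ_ : D → D → Set
  x ⊑ʰ y = ∀ z → Hl z → z ε x → z ε y

  ⊑ʰ-⊑ : ∀ {x y} → Hl x → x ⊑ʰ y → x ⊑ y
  ⊑ʰ-⊑ h f z zx = f z (Hl-member zx h) zx

  ⊑-⊑ʰ : ∀ {x y} → x ⊑ y → x ⊑ʰ y
  ⊑-⊑ʰ f z _ zx = f z zx

  ∃ʰ : (D → Set) → Set
  ∃ʰ P = ((x : D) → Hl x → P x → Bot) → Bot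

  unʰ : ∀ {P} → ∃ʰ P → ∃ λ x → Hl x × P x
  unʰ e k = e (λ x h p → k x (h , p))

  Levʰ : D → Set
  Levʰ l = Sem (Level 0 (dp 1 0 0) ʰ) (l ∙ point₁) point₂

  -- The cores of the members of a history form a history in the sense of LT.
  core-Levʰ : ∀ {H s t} → Lev H s → Core s t → Levʰ t
  core-Levʰ {H} {s} {t} L C = do
    -- The cores of members of `H`. Each is a helow subset of a member of `H`, hence in `t`, so
    -- separating from `t` loses none.
    (k , K) ← separate (∃∈ 0 (λ d → ∀ᵇ λ z → z ∈ᵇ 1 ⇔ᵇ (z ∈ᵇ d ∧ᵇ Helow z)) (dp 2 0 0)) (H ∙ point₁) point₂ (low C)
    let
      coreOf : ∀ x → x ε k → ∃ λ d → d ε H × (∀ z → z ε x ⇔ (z ε d ∧ Hl z))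
      coreOf x xk = do
        (d , p) ← prop K xk
        (dH , q) ← p
        ⟨ d , (dH , q) ⟩
      core∈k : ∀ d → d ε H → ∃ λ x → Core d x × x ε k × Hl x
      core∈k d dH = do
        (x , X) ← core (m-low L dH)
        let hx = Hl-m-core (hist L) dH X
        ⟨ x , (X , intro K (intro C (into L dH (left (sub X))) hx)
                     ⟨ d , ⟨ dH , (λ z → ⟨ (λ zx → ⟨ sub X z zx , prop X zx ⟩) ,
                       (λ p → intro X (fst p) (snd p)) ⟩) ⟩ ⟩ , hx) ⟩
    λ n → n k (Hl-below (sub K) (Hl-core L C))
      ⟨ (λ x hx xk z hz → ⟨ (λ zx κ → do
            (d , (dH , q)) ← coreOf x xk
            -- The core of this `e` is the witness for `z`.
            (e , (ed , eH , z⊑e)) ← m-low-out (hist L) dH (fst (fst (q z) zx)) (Hl-low hz)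
            (c , (E , ck , hc)) ← core∈k e eH
            κ c hc ⟨ (λ w hw wz → intro E (z⊑e w wz) hw) ,
                  ⟨ snd (q c) ⟨ m-into L dH ed eH (left (sub E)) , hc ⟩ , ck ⟩ ⟩) ,
          (λ p → do
            (d , (dH , q)) ← coreOf x xk
            (c , (hc , r)) ← unʰ p
            (z⊑c , r) ← r
            (cx , _) ← r
            (e , (ed , eH , c⊑e)) ← m-low-out (hist L) dH (fst (fst (q c) cx)) (Hl-low hc)
            snd (q z) ⟨ m-into L dH ed eH (left λ w wz → c⊑e w (⊑ʰ-⊑ hz z⊑c w wz)) , hz ⟩) ⟩)
      , (λ z hz → ⟨ (λ zt κ → do
            (d , (dH , z⊑d)) ← low-out L (sub C z zt) (Hl-low hz)
            (c , (X , ck , hc)) ← core∈k d dH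
            κ c hc ⟨ (λ w hw wz → intro X (z⊑d w wz) hw) , ck ⟩) ,
          (λ p → do
            (c , (hc , r)) ← unʰ p
            (z⊑c , ck) ← r
            intro C (Lev-below L (sub C c (sub K c ck)) (Hl-low hc) (⊑ʰ-⊑ hz z⊑c)) hz) ⟩) ⟩
    where open Lev

  -- The axioms of LT for helow sets

  Holdsʰ : Fm → Set
  Holdsʰ φ = ∀ ρ σ → Sem (φ ʰ) ρ σ

  Extensionalityʰ : Holdsʰ Extensionality
  Extensionalityʰ ρ σ a ha b hb f = extensionality a b λ x →
    ⟨ (λ xa → fst (f x (Hl-member xa ha)) xa) , (λ xb → snd (f x (Hl-member xb hb)) xb) ⟩

  Separationʰ : Holdsʰ Separation
  Separationʰ ρ σ F a ha n = do
    (b , p) ← axiom (there (there (here refl))) F a (Hl-low ha)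
    (_ , q) ← p
    n b (Hl-below (λ x xb → snd (fst (q x) xb)) ha) (λ x _ → q x)

  Stratificationʰ : Holdsʰ Stratification
  Stratificationʰ ρ σ a ha n = do
    (s , (l , a⊑s)) ← stratify (Hl-low ha)
    (H , L) ← BLev-Lev l
    (t , C) ← core (Lev-low L)
    n t (Hl-core L C) ⟨ core-Levʰ L C , (λ x hx xa → intro C (a⊑s x xa) hx) ⟩

module EndlessSets {T : Theory} (M : Model T) (BLT⁺⊆T : ∀ {φ} → BLT⁺ φ → T φ) where
  open Model M
  open Interpretation M
  open Sets M (BLT⁺⊆T ∘ there)

  -- `l` is included in a boolean-level that is a low member of some `m`; so `l` is in `m`, and in
  -- its core.
  Endlessʰ : Holdsʰ Endless
  Endlessʰ ρ σ l hl _ n = do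
    (s , (bs , l⊑s)) ← stratify (Hl-low hl)
    (m , p) ← sound (hyp (BLT⁺⊆T (here refl))) point₁ point₂ s bs
    (bm , sm) ← p
    (_ , S) ← BLev-Lev bs
    (_ , L) ← BLev-Lev bm
    (t , C) ← core (Lev-low L)
    n t (Hl-core L C) ⟨ core-Levʰ L C , intro C (Lev-below L sm (Lev-low S) l⊑s) hl ⟩
    where open IsSep

-- The axioms of ZF for helow sets

module ZFSets {T : Theory} (M : Model T) (BLT-ZF⊆T : ∀ {φ} → BLT-ZF φ → T φ) where
  open Model M
  open Interpretation M
  open Sets M (BLT-ZF⊆T ∘ there ∘ there)
  open IsSep

  infinity : ∃ λ l → BLev l × (∃ λ q → q ε l × BLev q) ×
             (∀ q → q ε l → BLev q → ∃ λ r → r ε l × BLev r × q ε r)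
  infinity = do
    (l , p) ← sound (hyp (BLT-ZF⊆T (here refl))) point₁ point₂
    (bl , p) ← p
    (e , f) ← p
    (q , r) ← e
    (ql , bq) ← r
    ⟨ l , (bl , ⟨ q , (ql , bq) ⟩ , λ q ql bq → do
      (r , p) ← f q ql bq
      (rl , p) ← p
      (br , qr) ← p
      ⟨ r , (rl , br , qr) ⟩) ⟩

  bounded-image : ∀ ψ ρ σ →
    (∀ x → ∃ λ y → Sem ψ (x ∙ y ∙ ρ) σ × (∀ y' → Sem ψ (x ∙ y' ∙ ρ) σ → y' ≈ y)) →
    ∀ {a} → Low a → ∃ λ s → BLev s × (∀ x → x ε a → ∃ λ y → Sem ψ (x ∙ y ∙ ρ) σ × y ε s)
  bounded-image ψ ρ σ f {a} la = do
    (P , p) ← comprehend₂ ψ ρ σ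
    (s , q) ← sound (hyp (BLT-ZF⊆T (there (here refl)))) point₁ point₂ P
      (λ x → do
        (y , (s , u)) ← f x
        ⟨ y , ⟨ proj₂ (p x y) s , (λ y' Pxy' → u y' (proj₁ (p x y') Pxy')) ⟩ ⟩) a la
    (bs , g) ← q
    ⟨ s , (bs , λ x xa → do
      (y , r) ← g x xa
      (Pxy , ys) ← r
      ⟨ y , (proj₁ (p x y) Pxy , ys) ⟩) ⟩

  -- The function with value `a` on members of `r` and `b` elsewhere takes both values on `l`: `a`
  -- at `q` and `b` at `r`.
  common-level : ∀ a b → ∃ λ s → BLev s × a ε s × b ε s
  common-level a b = do
    (l , (bl , Q , next)) ← infinity
    (q , (ql , bq)) ← Q
    (r , (rl , br , qr)) ← next q ql bq
    (_ , L) ← BLev-Lev bl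
    (_ , R) ← BLev-Lev br
    (s , (bs , f)) ← bounded-image
      (((4 ∈ᵇ 2 ⇒ᵇ 3 ≐ᵇ 0) ∧ᵇ (4 ∉ᵇ 2 ⇒ᵇ 3 ≐ᵇ 1)) (dp 5 0 0)) (r ∙ b ∙ a ∙ point₁) point₂
      (λ x → em (x ε r)
        (λ xr → ⟨ a , (⟨ (λ _ → ≈-refl) , (λ n → absurd (n xr)) ⟩ , λ y p → fst p xr) ⟩)
        (λ n → ⟨ b , (⟨ (λ xr → absurd (n xr)) , (λ _ → ≈-refl) ⟩ , λ y p → snd p n) ⟩))
      (Lev-low L)
    (y , (p , ys)) ← f q ql
    (z , (p' , zs)) ← f r rl
    ⟨ s , (bs , ≈-ε (fst p qr) ys , ≈-ε (snd p' (Lev-low R)) zs) ⟩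

  Pairingʰ : Holdsʰ Pairing
  Pairingʰ ρ σ a ha b hb n = do
    (s , (bs , as , bs')) ← common-level a b
    (_ , L) ← BLev-Lev bs
    (t , C) ← core (Lev-low L)
    (c , S) ← separate ((2 ≐ᵇ 0 ∨ᵇ 2 ≐ᵇ 1) (dp 3 0 0)) (b ∙ a ∙ point₁) point₂ (low C)
    n c (Hl-below (sub S) (Hl-core L C)) λ x hx → ⟨ prop S , (λ p → intro S
      (either p (λ e → ≈-ε (≈-sym e) (intro C as ha)) (λ e → ≈-ε (≈-sym e) (intro C bs' hb))) p) ⟩

  Unionʰ : Holdsʰ Union
  Unionʰ ρ σ a ha n = do
    (c , p) ← ha
    (t , p) ← p
    (a⊑c , l) ← p
    -- The transitive set `c` includes the union, and is low, as otherwise it would be one of its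
    -- own low members.
    (u , S) ← separate (∃∈ 0 (λ x → 1 ∈ᵇ x) (dp 2 0 0)) (a ∙ point₁) point₂ (λ cc → l c cc cc)
    n u ⟨ c , ⟨ t , ⟨ sub S , l ⟩ ⟩ ⟩ λ y hy → ⟨ (λ yu κ → do
          (x , q) ← prop S yu
          (xa , yx) ← q
          κ x (Hl-member xa ha) ⟨ xa , yx ⟩) ,
        (λ e → do
          (x , (hx , q)) ← unʰ e
          (xa , yx) ← q
          intro S (t x (a⊑c x xa) y yx) ⟨ x , ⟨ xa , yx ⟩ ⟩) ⟩

  Powersetʰ : Holdsʰ Powerset
  Powersetʰ ρ σ a ha n = do
    (s , (bs , as , _)) ← common-level a a
    (_ , L) ← BLev-Lev bs
    (p , S) ← separate ((1 ⊆ᵇ 0) (dp 2 0 0)) (a ∙ point₁) point₂ (Lev-low L)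
    n p (Hl-intro (low S) (λ x xp → Hl-below (prop S xp) ha)) λ x hx →
      ⟨ (λ xp → ⊑-⊑ʰ (prop S xp)) ,
        (λ x⊑a → intro S (Lev-below L as (Hl-low ha) (⊑ʰ-⊑ hx x⊑a)) (⊑ʰ-⊑ hx x⊑a)) ⟩

  -- `d` is bpot(d ∩ H), and d ∩ H is a history because `m-transitive` keeps the members in `H` of
  -- its members inside `d`. This makes Infinity applicable to members of `H`.
  m-BLev : ∀ {H d} → Hist H → d ε H → BLev d
  m-BLev {H} {d} hH dH = do
    (h , S) ← separate ((1 ∈ᵇ 0) (dp 2 0 0)) (d ∙ point₁) point₂ H-low
    ⟨ h , ⟨ ⟨ low S , (λ x xh z → ⟨ (λ zx → do
              (e , (ex , eH , n)) ← m-out (sub S x xh) zx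
              ⟨ e , ⟨ ex , ⟨ intro S eH (m-transitive hH dH (prop S xh) (sub S x xh) e ex) , ⟨ m-low eH , n ⟩ ⟩ ⟩ ⟩) ,
            (λ p → do
              (e , p) ← p
              (ex , p) ← p
              (eh , p) ← p
              (_ , n) ← p
              m-into (sub S x xh) ex (sub S e eh) n) ⟩) ⟩ ,
          (λ z → ⟨ (λ zd → do
              (e , (ed , eH , n)) ← m-out dH zd
              ⟨ e , ⟨ intro S eH ed , ⟨ m-low eH , n ⟩ ⟩ ⟩) ,
            (λ p → do
              (e , p) ← p
              (eh , p) ← p
              (_ , n) ← p
              m-into dH (prop S eh) (sub S e eh) n) ⟩) ⟩ ⟩
    where open Hist hH

  -- The core of the limit level `l` is inductive: an `x` in it lies below some `d` in `H`, a later
  -- level `r` in `l` contains `d`, and x ∪ {x} is a subset of `r`, hence in `l`.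
  Infinityʰ : Holdsʰ Infinity
  Infinityʰ ρ σ n = do
    (l , (bl , Q , next)) ← infinity
    (q , (ql , bq)) ← Q
    (_ , L) ← BLev-Lev bl
    (_ , K) ← BLev-Lev bq
    (w , W) ← core (Lev-low L)
    (e , E) ← separate ⊥' point₁ point₂ (Lev-low L)
    let
      he : Hl e
      he = Hl-intro (low E) (λ x xe → absurd (prop E xe))
    n w (Hl-core L W)
      ⟨ (λ κ → κ e he ⟨ intro W (Lev-below L ql (Lev-low K) (λ x xe → absurd (prop E xe))) he ,
                        (λ z _ → prop E) ⟩) ,
        (λ x hx xw κ → do
          (d , (dH , x⊑d)) ← low-out L (sub W x xw) (Hl-low hx)
          (r , (rl , br , dr)) ← next d (member-ε L dH) (m-BLev (Lev.hist L) dH)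
          (_ , R) ← BLev-Lev br
          (s , S) ← separate ((1 ∈ᵇ 0 ∨ᵇ 1 ≐ᵇ 0) (dp 2 0 0)) (x ∙ point₁) point₂ (Lev-low R)
          let
            xr = Lev-below R dr (Lev.m-low L dH) x⊑d
            hs : Hl s
            hs = Hl-intro (low S) λ z zs → either (prop S zs) (λ zx → Hl-member zx hx)
              (λ e → leibniz Helow₀ {ρ = point₁} {σ = point₂} (≈-sym e) hx)
          κ s hs ⟨ intro W (Lev-below L rl (Lev-low R) (sub S)) hs ,
            (λ z hz → ⟨ prop S , (λ p → intro S (either p (Lev-transitive R xr (Hl-low hx) z)
              (λ e → ≈-ε (≈-sym e) xr)) p) ⟩) ⟩) ⟩

  Replacementʰ : Holdsʰ Replacement
  Replacementʰ ρ σ P f a ha n = do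
    (s , (bs , g)) ← bounded-image
      -- `Unbounded∉` needs a function on all sets, so `P` is extended by the identity outside the
      -- helow sets.
      (((Helow 1 ⇒ᵇ Helow 0 ∧ᵇ F2 0 1 0) ∧ᵇ (¬ᵇ (Helow 1) ⇒ᵇ 0 ≐ᵇ 1)) (dp 2 0 1)) point₁ σ'
      (λ x → em (Hl x)
        (λ hx → do
          (y , (hy , p)) ← unʰ (f x hx)
          (Pxy , u) ← p
          ⟨ y , (⟨ (λ _ → ⟨ hy , Pxy ⟩) , (λ n → absurd (n hx)) ⟩ ,
                 λ y' p → u y' (fst (fst p hx)) (snd (fst p hx))) ⟩)
        (λ nx → ⟨ x , (⟨ (λ hx → absurd (nx hx)) , (λ _ → ≈-refl) ⟩ , λ y' p → snd p nx) ⟩))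
      (Hl-low ha)
    (_ , L) ← BLev-Lev bs
    (t , C) ← core (Lev-low L)
    (b , S) ← separate (∃∈ 0 (λ x → F2 0 x 1) (dp 2 0 1)) (a ∙ point₁) σ' (low C)
    n b (Hl-below (sub S) (Hl-core L C)) λ y hy → ⟨ (λ yb κ → do
          (x , p) ← prop S yb
          (xa , Pxy) ← p
          κ x (Hl-member xa ha) ⟨ xa , Pxy ⟩) ,
        (λ e → do
          (x , (hx , p)) ← unʰ e
          (xa , Pxy) ← p
          (y' , (q , y's)) ← g x xa
          (y₀ , (_ , r)) ← unʰ (f x hx)
          (_ , u) ← r
          let hy' = fst (fst q hx)
              y'≈y₀ = u y' hy' (snd (fst q hx))
              y≈y₀ = u y hy Pxy
          intro S (≈-ε (≈-sym y≈y₀) (≈-ε y'≈y₀ (intro C y's hy'))) ⟨ x , ⟨ xa , Pxy ⟩ ⟩) ⟩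
    where σ' = push 2 P point₂

  -- A member of `a` of least rank is minimal; `c` is a minimal member of `H` among those that
  -- include a member of `a`.
  Foundationʰ : Holdsʰ Foundation
  Foundationʰ ρ σ a ha e n = do
    (x , (hx , xa)) ← unʰ e
    (s , (bs , a⊑s)) ← stratify (Hl-low ha)
    (H , L) ← BLev-Lev bs
    (G , S) ← separate (∃∈ 0 (λ x → x ⊆ᵇ 1) (dp 2 0 0)) (a ∙ point₁) point₂ (Lev.H-low L)
    (d , (dH , x⊑d)) ← low-out L (a⊑s x xa) (Hl-low hx)
    (c , (cG , min)) ← minimal (Lev.hist L) (sub S) (intro S dH ⟨ x , ⟨ xa , x⊑d ⟩ ⟩)
    (y , p) ← prop S cG
    (ya , y⊑c) ← p
    n y (Hl-member ya ha) ⟨ ya , (λ z hz zy za → do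
      (f , (fc , fH , z⊑f)) ← m-low-out (Lev.hist L) (sub S c cG) (y⊑c z zy) (Hl-low hz)
      min f fc (intro S fH ⟨ z , ⟨ za , z⊑f ⟩ ⟩)) ⟩

-- In each model of `T`, soundness for restricted formulas is applied in the constant environment at
-- one helow set, and `Sem-local` passes to the given one.
transfer : ∀ {T U φ} (BLT⊆T : ∀ {ψ} → BLT ψ → T ψ) →
           ((M : Model T) → ∀ {ψ} → U ψ → Sets.Holdsʰ M BLT⊆T ψ) →
           Sentence φ → U ⊢ φ → T ⊢ φ ʰ
transfer {φ = φ} BLT⊆T axioms φ-closed d = completeness λ M ρ σ →
  let open Model M
      open Interpretation M
      open Sets M BLT⊆T
  in Sem-stable (φ ʰ) ρ σ λ k → Hl-exists λ e he →
       k (proj₁ (Sem-local φ (λ _ → e) ρ σ φ-closed (λ _ ()))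
           (sound-ʰ (axioms M) d (λ _ → e) σ (λ _ → he)))

LT-ʰ : ∀ {T} (BLT⊆T : ∀ {ψ} → BLT ψ → T ψ) (M : Model T) → ∀ {ψ} → LT ψ → Sets.Holdsʰ M BLT⊆T ψ
LT-ʰ BLT⊆T M (here refl)                 = Sets.Extensionalityʰ M BLT⊆T
LT-ʰ BLT⊆T M (there (here refl))         = Sets.Separationʰ M BLT⊆T
LT-ʰ BLT⊆T M (there (there (here refl))) = Sets.Stratificationʰ M BLT⊆T

LT⁺-ʰ : (M : Model BLT⁺) → ∀ {ψ} → LT⁺ ψ → Sets.Holdsʰ M there ψ
LT⁺-ʰ M (here refl) = EndlessSets.Endlessʰ M id
LT⁺-ʰ M (there p)   = LT-ʰ there M p

ZF-ʰ : (M : Model BLT-ZF) → ∀ {ψ} → ZF ψ → Sets.Holdsʰ M (there ∘ there) ψ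
ZF-ʰ M = λ
  { (here refl)                                                         → Extensionalityʰ
  ; (there (here refl))                                                 → Separationʰ
  ; (there (there (here refl)))                                         → Pairingʰ
  ; (there (there (there (here refl))))                                 → Unionʰ
  ; (there (there (there (there (here refl)))))                         → Powersetʰ
  ; (there (there (there (there (there (here refl))))))                 → Infinityʰ
  ; (there (there (there (there (there (there (here refl)))))))         → Replacementʰ
  ; (there (there (there (there (there (there (there (here refl)))))))) → Foundationʰ }
  where
  open Sets M (there ∘ there)
  open ZFSets M id

theorem15 : (φ : Fm) → Sentence φ →
    (LT ⊢ φ → BLT ⊢ φ ʰ) × (LT⁺ ⊢ φ → BLT⁺ ⊢ φ ʰ) × (ZF ⊢ φ → BLT-ZF ⊢ φ ʰ)
theorem15 φ s =
  transfer id (LT-ʰ id) s , transfer there LT⁺-ʰ s , transfer (there ∘ there) ZF-ʰ s
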